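{- For all sufficiently large $n$, $$|\mathrm{PPM}^*(S_n \mid S_1\cdots S_{n-1})| \leq (2^n + 2n + n^2)\log_2(n^5) + \log_2\!\big((n-1)^n\, n^{2^{n+1}}\big),$$ where $|\mathrm{PPM}^*(S_n \mid S_1\cdots S_{n-1})|$ is the total contribution of the bits of $S_n$ to the PPM* encoding of $S$ when $S_n$ is encoded after $S_1\cdots S_{n-1}$ has been processed.
   Context: Strings are binary, indexed from $0$; $x[i..j]$ is bits $i$ through $j$; $x^t$ is $t$-fold concatenation; $\mathrm{occ}(w,x)$ is the number of positions at which $w$ occurs as a substring of $x$ (for $w$ empty, $|x|+1$). For $n\ge1$, $db(n)$ is the lexicographically least de Bruijn string of order $n$ (length $2^n$, cyclically containing every length-$n$ binary string exactly once), built by: start with $x=1^{n-1}$; while possible append a bit (preferring $0$) keeping every length-$n$ substring of $x$ unique; then delete the prefix $1^{n-1}$. $db_i(n)=db(n)[i..2^n-1]\,db(n)[0..i-1]$ and $db_i^t(n)$ is its $t$-fold concatenation. For $n=2^st$ with $t$ odd, $S_n = db_0^t(n)\,db_1^t(n)\cdots db_{2^s-1}^t(n)$; $S=S_1S_2S_3\cdots$. PPM* (escape Method C, no exclusion). If $x$ is the input read so far, the model consists of $\lambda$ and every nonempty string $c$ such that $\mathrm{occ}(cb,x)\ge1$ for some bit $b$ and $c$ with its last bit removed occurs at least twice in $x$. For context $c$: count of bit $b$ is $\mathrm{occ}(cb,x)$; escape count $e(c)$ = number of bits with positive count; with $T$ = sum of the two counts and $e(c)$, bit $b$ gets probability $\mathrm{occ}(cb,x)/T$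 and escape gets $e(c)/T$; $c$ is deterministic if $e(c)=1$. Relevant contexts are model contexts that are suffixes of $x$. To encode the next bit $b$: the current context is the shortest deterministic relevant context if one exists, else the longest relevant context. While the current context $c$ has count $0$ for $b$: an escape is emitted with probability $e(c)/T$ (if $c$ has any prediction) and the current context becomes the longest relevant context shorter than $c$; if $c=\lambda$, $b$ is emitted with probability $1/2$ and encoding of $b$ ends. When the current context has positive count for $b$, $b$ is emitted with its probability. The contribution of a bit is $-\log_2$ of the product of the probabilities emitted while encoding it; then the model is updated. -}

module Defs where

open import Data.Bool using (Bool; true; false; _∧_; _∨_; not; if_then_else_)
open import Data.Nat using (ℕ; zero; suc; _+_; _*_; _∸_; _^_; _≡ᵇ_; _<ᵇ_; _%_; _/_)
open import Data.List using (List; []; _∷_; _++_; length; drop; take; replicate; concat; map; upTo; reverse; _∷ʳ_)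
open import Data.Product using (_×_; _,_; proj₁; proj₂)

-- Binary strings: false = bit 0, true = bit 1.
Str : Set
Str = List Bool

eqBit : Bool → Bool → Bool
eqBit true true = true
eqBit false false = true
eqBit _ _ = false

eqStr : Str → Str → Bool
eqStr [] [] = true
eqStr (a ∷ u) (b ∷ v) = eqBit a b ∧ eqStr u v
eqStr _ _ = false

isPrefix : Str → Str → Bool
isPrefix [] _ = true
isPrefix (a ∷ w) [] = false
isPrefix (a ∷ w) (c ∷ x) = eqBit a c ∧ isPrefix w x

suffixes : Str → List Str
suffixes [] = [] ∷ []
suffixes (a ∷ x) = (a ∷ x) ∷ suffixes x

countB : {A : Set} → (A → Bool) → List A → ℕ
countB p [] = 0
countB p (a ∷ as) = if p a then suc (countB p as) else countB p as

filterB : {A : Set} → (A → Bool) → List A → List A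
filterB p [] = []
filterB p (a ∷ as) = if p a then a ∷ filterB p as else filterB p as

-- occ(w,x): number of positions at which w occurs in x (|x|+1 if w empty)
occ : Str → Str → ℕ
occ w x = countB (isPrefix w) (suffixes x)

-- de Bruijn strings (greedy, prefer-0 construction)

windows : ℕ → Str → List Str
windows n x = map (take n) (filterB (λ t → not (length t <ᵇ n)) (suffixes x))

allDistinct : List Str → Bool
allDistinct [] = true
allDistinct (w ∷ ws) = (countB (eqStr w) ws ≡ᵇ 0) ∧ allDistinct ws

uniqueWindows : ℕ → Str → Bool
uniqueWindows n x = allDistinct (windows n x)

-- greedy loop; fuel 2^n suffices since each append creates a new distinct
-- length-n substring, so at most 2^n appends are possible.
dbLoop : ℕ → ℕ → Str → Str
dbLoop n zero x = x
dbLoop n (suc f) x =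
  if uniqueWindows n (x ∷ʳ false) then dbLoop n f (x ∷ʳ false)
  else (if uniqueWindows n (x ∷ʳ true) then dbLoop n f (x ∷ʳ true) else x)

db : ℕ → Str
db n = drop (n ∸ 1) (dbLoop n (2 ^ n) (replicate (n ∸ 1) true))

dbRot : ℕ → ℕ → Str
dbRot n i = drop i (db n) ++ take i (db n)

pow : Str → ℕ → Str
pow w t = concat (replicate t w)

-- (s , t) with m = 2^s * t, t odd (for m ≥ 1); fuel m suffices
twoAdic : ℕ → ℕ × ℕ
twoAdic m = go m m
  where
  go : ℕ → ℕ → ℕ × ℕ
  go zero k = (0 , k)
  go (suc f) k =
    if (k % 2 ≡ᵇ 0) ∧ not (k ≡ᵇ 0)
    then (suc (proj₁ (go f (k / 2))) , proj₂ (go f (k / 2)))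
    else (0 , k)

Sblock : ℕ → Str
Sblock n = concat (map (λ i → pow (dbRot n i) t) (upTo (2 ^ s)))
  where
  s = proj₁ (twoAdic n)
  t = proj₂ (twoAdic n)

prefixS : ℕ → Str
prefixS n = concat (map (λ k → Sblock (suc k)) (upTo (n ∸ 1)))

-- PPM* (escape method C, no exclusion)

dropLast : Str → Str
dropLast [] = []
dropLast (a ∷ []) = []
dropLast (a ∷ b ∷ x) = a ∷ dropLast (b ∷ x)

cnt : Str → Str → Bool → ℕ
cnt x c b = occ (c ∷ʳ b) x

pos : ℕ → ℕ
pos zero = 0
pos (suc _) = 1

esc : Str → Str → ℕ
esc x c = pos (cnt x c false) + pos (cnt x c true)

total : Str → Str → ℕ
total x c = cnt x c false + cnt x c true + esc x c

inModel : Str → Str → Bool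
inModel x [] = true
inModel x (a ∷ c) =
  not (esc x (a ∷ c) ≡ᵇ 0) ∧ not (occ (dropLast (a ∷ c)) x <ᵇ 2)

suf : Str → ℕ → Str
suf x k = drop (length x ∸ k) x

relevant : Str → List ℕ
relevant x = filterB (λ k → inModel x (suf x k)) (upTo (suc (length x)))

firstOr : ℕ → List ℕ → ℕ
firstOr d [] = d
firstOr d (k ∷ _) = k

lastOr : ℕ → List ℕ → ℕ
lastOr d [] = d
lastOr d (k ∷ []) = k
lastOr d (_ ∷ k ∷ ks) = lastOr d (k ∷ ks)

startLen : Str → ℕ
startLen x with filterB (λ k → esc x (suf x k) ≡ᵇ 1) (relevant x)
... | k ∷ _ = k
... | [] = lastOr 0 (relevant x)

-- probabilities as (numerator , denominator)
Prob : Set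
Prob = ℕ × ℕ

_⊗_ : Prob → Prob → Prob
(a , b) ⊗ (c , d) = (a * c , b * d)

-- walk the relevant contexts in decreasing length, starting at the current
-- one; the list ends with λ (length 0), after which b is emitted with 1/2.
walk : Str → Bool → List ℕ → Prob
walk x b [] = (1 , 2)
walk x b (k ∷ ks) =
  if (cnt x c b ≡ᵇ 0)
  then ((if esc x c ≡ᵇ 0 then (1 , 1) else (esc x c , total x c)) ⊗ walk x b ks)
  else (cnt x c b , total x c)
  where c = suf x k

encodeBit : Str → Bool → Prob
encodeBit x b =
  walk x b (reverse (filterB (λ k → not (startLen x <ᵇ k)) (relevant x)))

encodeSeq : Str → Str → Prob
encodeSeq x [] = (1 , 1)
encodeSeq x (b ∷ y) = encodeBit x b ⊗ encodeSeq (x ∷ʳ b) y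

-- |PPM*(S_n | S_1 ... S_{n-1})| = - log2 (proj₁ / proj₂) of this
ppmSn : ℕ → Prob
ppmSn n = encodeSeq (prefixS n) (Sblock n)

-- 2 ^ (bound in the paper): n^(5 (2^n + 2n + n^2)) * (n-1)^n * n^(2^(n+1))
boundPow : ℕ → ℕ
boundPow n = n ^ (5 * (2 ^ n + 2 * n + n * n)) * ((n ∸ 1) ^ n * n ^ (2 ^ (suc n)))

{-# OPTIONS --safe #-}
-- In S_n every context of length at most n − 3 predicts both bits, so a bit costs at most one
-- escape.  Let w be the common part of the n rotations of db(n) that make up S_n.
-- In the first rotation a bit following the (n−3)-window u costs at most log (T·T), T − 2 being
-- the number of occurrences of u in the text X = S_1 ... S_n; since u occurs at most 15 times in w, these T add up to O(|X|) = O(n 2^n), so on average log T is log n + O(1).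
-- In the j-th later rotation take the preceding window of length n + n^4.  If it never occurs
-- in X with the wrong continuation, it is a deterministic context with count at least j, and
-- the bit costs at most log ((j+1)/j), which telescopes to log n over all rotations.  Wrong
-- continuations lie more than n^4 apart, because n-windows are unique in w, so the remaining
-- positions are so few that the trivial bound 6n per bit suffices for them.
-- The total is 3·2^n log n + O(2^n), which is below the 7·2^n log n contained in the stated bound.
module Submission where

open import Defs
open import Data.Bool using (Bool; true; false; _∧_; not; if_then_else_)
open import Data.Empty using (⊥-elim)
open import Data.List using (List; []; _∷_; _++_; length; drop; take; _∷ʳ_; map; concat; replicate; reverse; upTo; initLast; _∷ʳ′_)
open import Data.List.Properties using (++-assoc; ++-identityʳ; length-++; length-++-≤ʳ; length-++-comm; length-map; length-replicate; length-drop; length-take; length-upTo; ∷-injective; ∷ʳ-injective; reverse-++; drop-drop; take++drop≡id; concat-concat; concat-++; map-∘; map-++; map-cong; upTo-∷ʳ)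
open import Data.List.Membership.Propositional using (_∈_)
open import Data.List.Membership.Propositional.Properties using (∈-++⁺ˡ; ∈-++⁺ʳ; ∈-++⁻; ∈-map⁺; ∈-upTo⁺; ∈-upTo⁻)
open import Data.List.Relation.Unary.All as All using (All; []; _∷_)
import Data.List.Relation.Unary.All.Properties as AllP
open import Data.List.Relation.Unary.AllPairs using (AllPairs; []; _∷_)
import Data.List.Relation.Unary.AllPairs.Properties as AllPairsP
open import Data.List.Relation.Unary.Any using (here; there)
open import Data.Nat
open import Data.Nat.DivMod using (m≡m%n+[m/n]*n; m%n<n; m/n*n≤m)
open import Data.Nat.ListAction using (sum)
open import Data.Nat.Properties
open import Data.Nat.Tactic.RingSolver using (solve-∀)
open import Data.Product using (_×_; _,_; proj₁; proj₂; ∃-syntax)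
open import Data.Sum using (_⊎_; inj₁; inj₂)
open import Data.Unit using (⊤; tt)
open import Function using (id)
open import Relation.Binary.PropositionalEquality
open import Relation.Nullary using (yes; no; contradiction)
open import Relation.Nullary.Decidable using (toWitness)

-- Occurrence counts

-- The one-escape argument needs every word of length n - 2 in the text before the block. So the
-- greedy construction has to be proved complete, and its loop may either spend its fuel or reach a
-- dead end; both outcomes are treated. Logarithms never appear: a cost of at most log (α/β) is an
-- inequality between products of natural numbers. Each rotation is charged exactly 2^n factors, so
-- that the fractions (j+1)/j of consecutive rotations cancel. The word w is db(n) without its first
-- n bits: the offsets stay below 2^s ≤ n, so rotating only moves bits among those n. The length n^4
-- balances two errors over at most n rotations. The first n + n^4 bits of w have no full window
-- before them inside w and cost O(n^6) in total; the wrong continuations number O(2^n / n^3) and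
-- cost 6n each per rotation, O(2^n / n) in total. The bound 6n per bit comes from T ≤ 2^(3n).

𝟙 : Bool → ℕ
𝟙 true = 1
𝟙 false = 0

𝟙≤1 : ∀ p → 𝟙 p ≤ 1
𝟙≤1 true = ≤-refl
𝟙≤1 false = z≤n

∑ : {A : Set} → (A → ℕ) → List A → ℕ
∑ f xs = sum (map f xs)

∑-mono : {A : Set} {f g : A → ℕ} (xs : List A) → (∀ a → f a ≤ g a) → ∑ f xs ≤ ∑ g xs
∑-mono [] le = z≤n
∑-mono (a ∷ xs) le = +-mono-≤ (le a) (∑-mono xs le)

+-interchange : ∀ a b c d → (a + b) + (c + d) ≡ (a + c) + (b + d)
+-interchange = solve-∀

∑-+ : {A : Set} (f g : A → ℕ) (xs : List A) → ∑ (λ a → f a + g a) xs ≡ ∑ f xs + ∑ g xs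
∑-+ f g [] = refl
∑-+ f g (a ∷ xs) = trans (cong (f a + g a +_) (∑-+ f g xs)) (+-interchange (f a) (g a) _ _)

∑-0 : {A : Set} (xs : List A) → ∑ (λ _ → 0) xs ≡ 0
∑-0 [] = refl
∑-0 (_ ∷ xs) = ∑-0 xs

∑-swap : {A B : Set} (f : A → B → ℕ) (as : List A) (bs : List B) →
         ∑ (λ a → ∑ (f a) bs) as ≡ ∑ (λ b → ∑ (λ a → f a b) as) bs
∑-swap f [] bs = sym (∑-0 bs)
∑-swap f (a ∷ as) bs =
  trans (cong (∑ (f a) bs +_) (∑-swap f as bs)) (sym (∑-+ (f a) _ bs))

∑-*ˡ : {A : Set} (c : ℕ) (f : A → ℕ) (xs : List A) → ∑ (λ a → c * f a) xs ≡ c * ∑ f xs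
∑-*ˡ c f [] = sym (*-zeroʳ c)
∑-*ˡ c f (a ∷ xs) = trans (cong (c * f a +_) (∑-*ˡ c f xs)) (sym (*-distribˡ-+ c (f a) _))

∑-≤-length : {A : Set} (f : A → ℕ) (c : ℕ) (xs : List A) → (∀ a → f a ≤ c) → ∑ f xs ≤ c * length xs
∑-≤-length f c [] le = z≤n
∑-≤-length f c (a ∷ xs) le =
  ≤-trans (+-mono-≤ (le a) (∑-≤-length f c xs le)) (≤-reflexive (sym (*-suc c (length xs))))

countB-∷ : {A : Set} (p : A → Bool) (a : A) (as : List A) → countB p (a ∷ as) ≡ 𝟙 (p a) + countB p as
countB-∷ p a as with p a
... | true = refl
... | false = refl

countB-∑ : {A : Set} (p : A → Bool) (as : List A) → countB p as ≡ ∑ (λ a → 𝟙 (p a)) as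
countB-∑ p [] = refl
countB-∑ p (a ∷ as) = trans (countB-∷ p a as) (cong (𝟙 (p a) +_) (countB-∑ p as))

length-suffixes : ∀ x → length (suffixes x) ≡ suc (length x)
length-suffixes [] = refl
length-suffixes (a ∷ x) = cong suc (length-suffixes x)

eqBit-refl : ∀ a → eqBit a a ≡ true
eqBit-refl true = refl
eqBit-refl false = refl

eqBit→≡ : ∀ a b → eqBit a b ≡ true → a ≡ b
eqBit→≡ true true _ = refl
eqBit→≡ false false _ = refl

∧-split : ∀ a b → a ∧ b ≡ true → a ≡ true × b ≡ true
∧-split true true _ = refl , refl

eqStr-refl : ∀ u → eqStr u u ≡ true
eqStr-refl [] = refl
eqStr-refl (a ∷ u) rewrite eqBit-refl a = eqStr-refl u

eqStr→≡ : ∀ u v → eqStr u v ≡ true → u ≡ v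
eqStr→≡ [] [] _ = refl
eqStr→≡ (a ∷ u) (b ∷ v) e with ∧-split (eqBit a b) _ e
... | e₁ , e₂ = cong₂ _∷_ (eqBit→≡ a b e₁) (eqStr→≡ u v e₂)

isPrefix-++ : ∀ w s → isPrefix w (w ++ s) ≡ true
isPrefix-++ [] s = refl
isPrefix-++ (a ∷ w) s rewrite eqBit-refl a = isPrefix-++ w s

isPrefix→++ : ∀ w x → isPrefix w x ≡ true → ∃[ s ] x ≡ w ++ s
isPrefix→++ [] x _ = x , refl
isPrefix→++ (a ∷ w) (b ∷ x) e with ∧-split (eqBit a b) _ e
... | e₁ , e₂ with isPrefix→++ w x e₂
... | s , refl = s , cong (_∷ w ++ s) (sym (eqBit→≡ a b e₁))

isPrefix-long : ∀ w x s → length w ≤ length x → isPrefix w (x ++ s) ≡ isPrefix w x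
isPrefix-long [] x s le = refl
isPrefix-long (a ∷ w) (b ∷ x) s (s≤s le) = cong (eqBit a b ∧_) (isPrefix-long w x s le)

isPrefix-short : ∀ w x → length x < length w → isPrefix w x ≡ false
isPrefix-short (a ∷ w) [] lt = refl
isPrefix-short (a ∷ w) (b ∷ x) (s≤s lt) with eqBit a b
... | true = isPrefix-short w x lt
... | false = refl

isPrefix-eqlen : ∀ w x → length w ≡ length x → isPrefix w x ≡ eqStr w x
isPrefix-eqlen [] [] e = refl
isPrefix-eqlen (a ∷ w) (b ∷ x) e = cong (eqBit a b ∧_) (isPrefix-eqlen w x (suc-injective e))

isPrefix-mono : ∀ w x s → 𝟙 (isPrefix w x) ≤ 𝟙 (isPrefix w (x ++ s))
isPrefix-mono [] x s = ≤-refl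
isPrefix-mono (a ∷ w) [] s = z≤n
isPrefix-mono (a ∷ w) (b ∷ x) s with eqBit a b
... | true = isPrefix-mono w x s
... | false = z≤n

occ-∷ : ∀ w a x → occ w (a ∷ x) ≡ 𝟙 (isPrefix w (a ∷ x)) + occ w x
occ-∷ w a x = countB-∷ (isPrefix w) (a ∷ x) (suffixes x)

occ-∑ : ∀ w x → occ w x ≡ ∑ (λ z → 𝟙 (isPrefix w z)) (suffixes x)
occ-∑ w x = countB-∑ (isPrefix w) (suffixes x)

occ-[] : ∀ w → occ w [] ≡ 𝟙 (isPrefix w [])
occ-[] [] = refl
occ-[] (_ ∷ _) = refl

occ-tail-≤ : ∀ w a x → occ w x ≤ occ w (a ∷ x)
occ-tail-≤ w a x rewrite occ-∷ w a x = m≤n+m _ _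

occ-++ʳ-≤ : ∀ w a x → occ w x ≤ occ w (a ++ x)
occ-++ʳ-≤ w [] x = ≤-refl
occ-++ʳ-≤ w (d ∷ a) x = ≤-trans (occ-++ʳ-≤ w a x) (occ-tail-≤ w d (a ++ x))

occ-drop-≤ : ∀ w k x → occ w (drop k x) ≤ occ w x
occ-drop-≤ w zero x = ≤-refl
occ-drop-≤ w (suc k) [] = ≤-refl
occ-drop-≤ w (suc k) (a ∷ x) = ≤-trans (occ-drop-≤ w k x) (occ-tail-≤ w a x)

occ-prefix : ∀ w s → 1 ≤ occ w (w ++ s)
occ-prefix [] [] = s≤s z≤n
occ-prefix [] (a ∷ s) = s≤s z≤n
occ-prefix (a ∷ w) s rewrite occ-∷ (a ∷ w) a (w ++ s) | isPrefix-++ (a ∷ w) s = s≤s z≤n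

occ-middle : ∀ w a s → 1 ≤ occ w (a ++ w ++ s)
occ-middle w a s = ≤-trans (occ-prefix w s) (occ-++ʳ-≤ w a (w ++ s))

occ→split : ∀ w x → 1 ≤ occ w x → ∃[ a ] ∃[ s ] x ≡ a ++ w ++ s
occ→split [] [] _ = [] , [] , refl
occ→split w (a ∷ x) le with isPrefix w (a ∷ x) in eq
... | true = [] , isPrefix→++ w (a ∷ x) eq
... | false with occ→split w x le
... | p , s , refl = a ∷ p , s , refl

-- The pattern is nonempty because the law fails for the empty one, which occurs `|x| + 1` times in
-- `x`.
occ-superadditive : ∀ c w x y → occ (c ∷ w) x + occ (c ∷ w) y ≤ occ (c ∷ w) (x ++ y)
occ-superadditive c w [] y = ≤-refl
occ-superadditive c w (a ∷ x) y
  rewrite occ-∷ (c ∷ w) a x | occ-∷ (c ∷ w) a (x ++ y)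
        | +-assoc (𝟙 (isPrefix (c ∷ w) (a ∷ x))) (occ (c ∷ w) x) (occ (c ∷ w) y)
  = +-mono-≤ (isPrefix-mono (c ∷ w) (a ∷ x) y) (occ-superadditive c w x y)

occ-++ˡ-≤ : ∀ w x y → occ w x ≤ occ w (x ++ y)
occ-++ˡ-≤ w [] y rewrite occ-[] w with w
... | [] = occ-prefix [] y
... | _ ∷ _ = z≤n
occ-++ˡ-≤ w (a ∷ x) y rewrite occ-∷ w a x | occ-∷ w a (x ++ y) =
  +-mono-≤ (isPrefix-mono w (a ∷ x) y) (occ-++ˡ-≤ w x y)

occ-≤-length : ∀ w x → occ w x ≤ suc (length x)
occ-≤-length w [] rewrite occ-[] w = 𝟙≤1 (isPrefix w [])
occ-≤-length w (a ∷ x) rewrite occ-∷ w a x = +-mono-≤ (𝟙≤1 (isPrefix w (a ∷ x))) (occ-≤-length w x)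

occ-short : ∀ w x → length x < length w → occ w x ≡ 0
occ-short w [] lt rewrite occ-[] w | isPrefix-short w [] lt = refl
occ-short w (a ∷ x) lt rewrite occ-∷ w a x | isPrefix-short w (a ∷ x) lt =
  occ-short w x (<-trans (n<1+n _) lt)

isPrefix-∷ʳ-≤ : ∀ c z → 𝟙 (isPrefix (c ∷ʳ false) z) + 𝟙 (isPrefix (c ∷ʳ true) z) ≤ 𝟙 (isPrefix c z)
isPrefix-∷ʳ-≤ [] [] = z≤n
isPrefix-∷ʳ-≤ [] (true ∷ z) = ≤-refl
isPrefix-∷ʳ-≤ [] (false ∷ z) = ≤-refl
isPrefix-∷ʳ-≤ (a ∷ c) [] = z≤n
isPrefix-∷ʳ-≤ (a ∷ c) (b ∷ z) with eqBit a b
... | true = isPrefix-∷ʳ-≤ c z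
... | false = z≤n

isPrefix-∷ʳ-≥ : ∀ c z → length c < length z →
  𝟙 (isPrefix c z) ≤ 𝟙 (isPrefix (c ∷ʳ false) z) + 𝟙 (isPrefix (c ∷ʳ true) z)
isPrefix-∷ʳ-≥ [] (true ∷ z) lt = ≤-refl
isPrefix-∷ʳ-≥ [] (false ∷ z) lt = ≤-refl
isPrefix-∷ʳ-≥ (a ∷ c) (b ∷ z) (s≤s lt) with eqBit a b
... | true = isPrefix-∷ʳ-≥ c z lt
... | false = z≤n

cnt-≤-occ : ∀ x c → cnt x c false + cnt x c true ≤ occ c x
cnt-≤-occ [] c rewrite occ-[] c | occ-[] (c ∷ʳ false) | occ-[] (c ∷ʳ true) = isPrefix-∷ʳ-≤ c []
cnt-≤-occ (a ∷ x) c
  rewrite occ-∷ c a x | occ-∷ (c ∷ʳ false) a x | occ-∷ (c ∷ʳ true) a x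
        | +-interchange (𝟙 (isPrefix (c ∷ʳ false) (a ∷ x))) (occ (c ∷ʳ false) x) (𝟙 (isPrefix (c ∷ʳ true) (a ∷ x))) (occ (c ∷ʳ true) x)
  = +-mono-≤ (isPrefix-∷ʳ-≤ c (a ∷ x)) (cnt-≤-occ x c)

length-∷ʳ : ∀ (c : Str) b → length (c ∷ʳ b) ≡ suc (length c)
length-∷ʳ c b = trans (length-++ c) (+-comm (length c) 1)

-- The occurrence of u at the end of y has no continuation.
cnt-<-occ-suffix : ∀ y u → suc (cnt (y ++ u) u false + cnt (y ++ u) u true) ≤ occ u (y ++ u)
cnt-<-occ-suffix [] u
  rewrite occ-short (u ∷ʳ false) u (≤-reflexive (sym (length-∷ʳ u false)))
        | occ-short (u ∷ʳ true) u (≤-reflexive (sym (length-∷ʳ u true)))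
  = subst (λ z → 1 ≤ occ u z) (++-identityʳ u) (occ-prefix u [])
cnt-<-occ-suffix (a ∷ y) u
  rewrite occ-∷ u a (y ++ u) | occ-∷ (u ∷ʳ false) a (y ++ u) | occ-∷ (u ∷ʳ true) a (y ++ u)
        | +-interchange (𝟙 (isPrefix (u ∷ʳ false) (a ∷ y ++ u))) (occ (u ∷ʳ false) (y ++ u)) (𝟙 (isPrefix (u ∷ʳ true) (a ∷ y ++ u))) (occ (u ∷ʳ true) (y ++ u))
  = ≤-trans (≤-reflexive (sym (+-suc _ _))) (+-mono-≤ (isPrefix-∷ʳ-≤ u (a ∷ y ++ u)) (cnt-<-occ-suffix y u))

-- The extra 1 is a possible occurrence at the very end, which no bit continues.
occ-≤-cnt : ∀ x c → occ c x ≤ suc (cnt x c false + cnt x c true)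
occ-≤-cnt [] c rewrite occ-[] c = ≤-trans (𝟙≤1 _) (s≤s z≤n)
occ-≤-cnt (a ∷ x) c with length (a ∷ x) ≤? length c
... | yes le = ≤-trans (≤-trans (≤-reflexive (occ-∷ c a x)) (≤-trans (+-mono-≤ (𝟙≤1 (isPrefix c (a ∷ x))) (≤-reflexive (occ-short c x le))) ≤-refl)) (s≤s z≤n)
... | no nle
  rewrite occ-∷ c a x | occ-∷ (c ∷ʳ false) a x | occ-∷ (c ∷ʳ true) a x
        | +-interchange (𝟙 (isPrefix (c ∷ʳ false) (a ∷ x))) (occ (c ∷ʳ false) x) (𝟙 (isPrefix (c ∷ʳ true) (a ∷ x))) (occ (c ∷ʳ true) x)
  = ≤-trans (+-mono-≤ (isPrefix-∷ʳ-≥ c (a ∷ x) (≰⇒> nle)) (occ-≤-cnt x c)) (≤-reflexive (+-suc _ _))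

isPrefix-tail-≤ : ∀ a c b x → 𝟙 (isPrefix (a ∷ c) (b ∷ x)) ≤ 𝟙 (isPrefix c x)
isPrefix-tail-≤ a c b x with eqBit a b
... | true = ≤-refl
... | false = z≤n

-- An occurrence of `a ∷ c` gives one of `c` a position later, hence never the one at the start of
-- `x`.
occ-∷ˡ-shift : ∀ a c x → 𝟙 (isPrefix c x) + occ (a ∷ c) x ≤ occ c x
occ-∷ˡ-shift a c [] rewrite occ-[] c = ≤-reflexive (+-identityʳ _)
occ-∷ˡ-shift a c (d ∷ x) rewrite occ-∷ c d x | occ-∷ (a ∷ c) d x =
  +-monoʳ-≤ (𝟙 (isPrefix c (d ∷ x)))
    (≤-trans (+-monoˡ-≤ _ (isPrefix-tail-≤ a c d x)) (occ-∷ˡ-shift a c x))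

occ-++ᶜ-≤ : ∀ e c x → occ (e ++ c) x ≤ occ c x
occ-++ᶜ-≤ [] c x = ≤-refl
occ-++ᶜ-≤ (a ∷ e) c x = ≤-trans (m+n≤o⇒n≤o _ (occ-∷ˡ-shift a (e ++ c) x)) (occ-++ᶜ-≤ e c x)

-- Only an occurrence at the very start has no bit before it; the last summand accounts for it.
occ-≤-predecessors : ∀ v y → occ v y ≤ (occ (false ∷ v) y + occ (true ∷ v) y) + 𝟙 (isPrefix v y)
occ-≤-predecessors v [] rewrite occ-[] v = ≤-refl
occ-≤-predecessors v (a ∷ y)
  rewrite occ-∷ v a y | occ-∷ (false ∷ v) a y | occ-∷ (true ∷ v) a y
  = ≤-trans (+-monoʳ-≤ (𝟙 (isPrefix v (a ∷ y))) (occ-≤-predecessors v y))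
      (≤-reflexive (trans (cong (λ q → 𝟙 (isPrefix v (a ∷ y)) + (occ (false ∷ v) y + occ (true ∷ v) y + q)) (split a))
        (rearrange (𝟙 (isPrefix v (a ∷ y))) (occ (false ∷ v) y) (occ (true ∷ v) y) (𝟙 (isPrefix (false ∷ v) (a ∷ y))) (𝟙 (isPrefix (true ∷ v) (a ∷ y))))))
  where
  split : ∀ a → 𝟙 (isPrefix v y) ≡ 𝟙 (isPrefix (false ∷ v) (a ∷ y)) + 𝟙 (isPrefix (true ∷ v) (a ∷ y))
  split true = refl
  split false = sym (+-identityʳ _)
  rearrange : ∀ p q r s t → p + (q + r + (s + t)) ≡ ((s + q) + (t + r)) + p
  rearrange = solve-∀

-- Greedy de Bruijn words

isPrefix-take : ∀ v t → length v ≤ length t → isPrefix v t ≡ eqStr v (take (length v) t)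
isPrefix-take [] t le = refl
isPrefix-take (a ∷ v) (b ∷ t) (s≤s le) = cong (eqBit a b ∧_) (isPrefix-take v t le)

<ᵇ-true : ∀ m n → (m <ᵇ n) ≡ true → m < n
<ᵇ-true m n e = <ᵇ⇒< m n (subst Data.Bool.T (sym e) _)

<ᵇ-false : ∀ m n → (m <ᵇ n) ≡ false → n ≤ m
<ᵇ-false m n e = ≮⇒≥ (λ lt → subst Data.Bool.T e (<⇒<ᵇ lt))

countB-windows : ∀ v (zs : List Str) →
  countB (isPrefix v) zs ≡ countB (eqStr v) (map (take (length v)) (filterB (λ t → not (length t <ᵇ length v)) zs))
countB-windows v [] = refl
countB-windows v (z ∷ zs) rewrite countB-∷ (isPrefix v) z zs with length z <ᵇ length v in eq
... | true rewrite isPrefix-short v z (<ᵇ-true _ _ eq) = countB-windows v zs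
... | false
  rewrite countB-∷ (eqStr v) (take (length v) z) (map (take (length v)) (filterB (λ t → not (length t <ᵇ length v)) zs))
        | isPrefix-take v z (<ᵇ-false _ _ eq) = cong (𝟙 (eqStr v (take (length v) z)) +_) (countB-windows v zs)

occ-windows : ∀ {n} v x → length v ≡ n → occ v x ≡ countB (eqStr v) (windows n x)
occ-windows v x refl = countB-windows v (suffixes x)

windows-length : ∀ n (zs : List Str) →
  All (λ v → length v ≡ n) (map (take n) (filterB (λ t → not (length t <ᵇ n)) zs))
windows-length n [] = []
windows-length n (z ∷ zs) with length z <ᵇ n in eq
... | true = windows-length n zs
... | false = trans (length-take n z) (m≤n⇒m⊓n≡m (<ᵇ-false _ _ eq)) ∷ windows-length n zs

allDistinct→count≤1 : ∀ ws → allDistinct ws ≡ true → ∀ v → countB (eqStr v) ws ≤ 1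
allDistinct→count≤1 [] e v = z≤n
allDistinct→count≤1 (w ∷ ws) e v with ∧-split (countB (eqStr w) ws ≡ᵇ 0) _ e
... | e₁ , e₂ with eqStr v w in eq
... | false = allDistinct→count≤1 ws e₂ v
... | true rewrite eqStr→≡ v w eq | ≡ᵇ⇒≡ (countB (eqStr w) ws) 0 (subst Data.Bool.T (sym e₁) _) = ≤-refl

¬allDistinct→repeat : {P : Str → Set} → ∀ ws → All P ws → allDistinct ws ≡ false →
  ∃[ v ] P v × 2 ≤ countB (eqStr v) ws
¬allDistinct→repeat (w ∷ ws) (pw ∷ pws) e with countB (eqStr w) ws in eq
... | suc c = w , pw , subst (2 ≤_) (sym (trans (countB-∷ (eqStr w) w ws) (cong₂ _+_ (cong 𝟙 (eqStr-refl w)) eq))) (s≤s (s≤s z≤n))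
... | zero with ¬allDistinct→repeat ws pws e
... | v , pv , le = v , pv , ≤-trans le (≤-trans (m≤n+m _ _) (≤-reflexive (sym (countB-∷ (eqStr v) w ws))))

Unique : ℕ → Str → Set
Unique n x = ∀ v → length v ≡ n → occ v x ≤ 1

uniqueWindows→Unique : ∀ n x → uniqueWindows n x ≡ true → Unique n x
uniqueWindows→Unique n x e v len =
  subst (_≤ 1) (sym (occ-windows v x len)) (allDistinct→count≤1 (windows n x) e v)

¬uniqueWindows→repeat : ∀ n x → uniqueWindows n x ≡ false → ∃[ v ] length v ≡ n × 2 ≤ occ v x
¬uniqueWindows→repeat n x e with ¬allDistinct→repeat (windows n x) (windows-length n (suffixes x)) e
... | v , len , le = v , len , subst (2 ≤_) (sym (occ-windows v x len)) le

-- Since `u` is one bit longer than `e`, the only window that the new bit creates is `e ∷ʳ b`.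
occ-∷ʳ : ∀ u a e b → length u ≡ suc (length e) →
  occ u ((a ++ e) ∷ʳ b) ≡ occ u (a ++ e) + 𝟙 (eqStr u (e ∷ʳ b))
occ-∷ʳ u [] e b len = trans (whole e len) (cong (_+ 𝟙 (eqStr u (e ∷ʳ b))) (sym (occ-short u e (≤-reflexive (sym len)))))
  where
  whole : ∀ e → length u ≡ suc (length e) → occ u (e ∷ʳ b) ≡ 𝟙 (eqStr u (e ∷ʳ b))
  whole [] len rewrite occ-∷ u b [] | isPrefix-eqlen u (b ∷ []) len | occ-short u [] (≤-reflexive (sym len)) = +-identityʳ _
  whole (d ∷ e) len
    rewrite occ-∷ u d (e ∷ʳ b)
          | isPrefix-eqlen u (d ∷ e ∷ʳ b) (trans len (cong suc (sym (length-∷ʳ e b))))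
          | occ-short u (e ∷ʳ b) (≤-reflexive (trans (cong suc (length-∷ʳ e b)) (sym len))) = +-identityʳ _
occ-∷ʳ u (d ∷ a) e b len
  rewrite occ-∷ u d ((a ++ e) ∷ʳ b) | occ-∷ u d (a ++ e)
        | isPrefix-long u (d ∷ a ++ e) (b ∷ []) (subst (_≤ suc (length (a ++ e))) (sym len) (s≤s (length-++-≤ʳ e {xs = a})))
        | occ-∷ʳ u a e b len = sym (+-assoc (𝟙 (isPrefix u (d ∷ a ++ e))) _ _)

-- The loop invariant. `prefer0` is the trace of the preference: a 1 is appended only where a 0
-- would repeat a window. `head` and `tail` locate the two ends, the only places where a word of
-- length `k` lacks a predecessor or a successor.
record Greedy (k : ℕ) (y : Str) : Set where
  field
    unique : Unique (suc k) y
    prefer0 : ∀ v → length v ≡ k → 1 ≤ occ (v ∷ʳ true) y → 1 ≤ occ (v ∷ʳ false) y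
    tail : ∃[ a ] ∃[ e ] y ≡ a ++ e × length e ≡ k
    head : ∃[ r ] y ≡ replicate k true ++ r

Stuck : ℕ → Str → Set
Stuck k y = ∀ b → uniqueWindows (suc k) (y ∷ʳ b) ≡ false

extension-repeats : ∀ k a e b → length e ≡ k → Unique (suc k) (a ++ e) →
  uniqueWindows (suc k) ((a ++ e) ∷ʳ b) ≡ false → 1 ≤ occ (e ∷ʳ b) (a ++ e)
extension-repeats k a e b len uniq dup with ¬uniqueWindows→repeat (suc k) ((a ++ e) ∷ʳ b) dup
... | v , lv , le rewrite occ-∷ʳ v a e b (trans lv (cong suc (sym len))) with eqStr v (e ∷ʳ b) in eq
... | false = ⊥-elim (<⇒≱ le (≤-trans (≤-reflexive (+-identityʳ _)) (uniq v lv)))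
... | true rewrite eqStr→≡ v (e ∷ʳ b) eq | +-comm (occ (e ∷ʳ b) (a ++ e)) 1 = s≤s⁻¹ le

shift-tail : ∀ (k : ℕ) (a e : Str) b → length e ≡ k →
  ∃[ a′ ] ∃[ e′ ] (a ++ e) ∷ʳ b ≡ a′ ++ e′ × length e′ ≡ k
shift-tail k a [] b len = (a ++ []) ∷ʳ b , [] , sym (++-identityʳ _) , len
shift-tail k a (d ∷ e) b len = a ∷ʳ d , e ∷ʳ b ,
  trans (++-assoc a (d ∷ e) _) (sym (++-assoc a (d ∷ []) (e ∷ʳ b))) , trans (length-∷ʳ e b) len

greedy-append : ∀ k y b → Greedy k y → uniqueWindows (suc k) (y ∷ʳ b) ≡ true →
  (b ≡ true → uniqueWindows (suc k) (y ∷ʳ false) ≡ false) → Greedy k (y ∷ʳ b)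
greedy-append k y b g uw why with Greedy.tail g
... | a , e , refl , len = record
  { unique = uniqueWindows→Unique (suc k) ((a ++ e) ∷ʳ b) uw
  ; prefer0 = pref
  ; tail = shift-tail k a e b len
  ; head = proj₁ (Greedy.head g) ∷ʳ b ,
           trans (cong (_∷ʳ b) (proj₂ (Greedy.head g))) (++-assoc (replicate k true) _ _)
  }
  where
  pref : ∀ v → length v ≡ k → 1 ≤ occ (v ∷ʳ true) ((a ++ e) ∷ʳ b) → 1 ≤ occ (v ∷ʳ false) ((a ++ e) ∷ʳ b)
  pref v lv le rewrite occ-∷ʳ (v ∷ʳ true) a e b (trans (length-∷ʳ v true) (cong suc (trans lv (sym len))))
    with eqStr (v ∷ʳ true) (e ∷ʳ b) in eq
  ... | false = ≤-trans (Greedy.prefer0 g v lv (subst (1 ≤_) (+-identityʳ _) le)) (occ-++ˡ-≤ (v ∷ʳ false) (a ++ e) (b ∷ []))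
  ... | true with ∷ʳ-injective v e (eqStr→≡ (v ∷ʳ true) (e ∷ʳ b) eq)
  ... | refl , refl = ≤-trans (extension-repeats k a e false len (Greedy.unique g) (why refl))
                        (occ-++ˡ-≤ (v ∷ʳ false) (a ++ e) (b ∷ []))

-- Completeness follows from either alternative: spending all the fuel produces enough windows for a
-- pigeonhole argument, and stopping earlier is a dead end, to which a balance argument applies.
dbLoop-greedy : ∀ k f y → Greedy k y → let y′ = dbLoop (suc k) f y in
  Greedy k y′ × length y′ ≤ length y + f × (length y′ ≡ length y + f ⊎ Stuck k y′)
dbLoop-greedy k zero y g = g , ≤-reflexive (sym (+-identityʳ _)) , inj₁ (sym (+-identityʳ _))
dbLoop-greedy k (suc f) y g with uniqueWindows (suc k) (y ∷ʳ false) in e₀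
... | true with dbLoop-greedy k f (y ∷ʳ false) (greedy-append k y false g e₀ (λ ()))
... | r rewrite length-∷ʳ y false | +-suc (length y) f = r
dbLoop-greedy k (suc f) y g | false with uniqueWindows (suc k) (y ∷ʳ true) in e₁
... | true with dbLoop-greedy k f (y ∷ʳ true) (greedy-append k y true g e₁ (λ _ → e₀))
... | r rewrite length-∷ʳ y true | +-suc (length y) f = r
dbLoop-greedy k (suc f) y g | false | false =
  g , m≤m+n _ _ , inj₂ λ { false → e₀ ; true → e₁ }

greedy-start : ∀ k → Greedy k (replicate k true)
greedy-start k = record
  { unique = λ v lv → ≤-trans (≤-reflexive (none v lv)) z≤n
  ; prefer0 = λ v lv le → ⊥-elim (<⇒≱ le (≤-reflexive (none (v ∷ʳ true) (trans (length-∷ʳ v true) (cong suc lv)))))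
  ; tail = [] , replicate k true , refl , length-replicate k
  ; head = [] , sym (++-identityʳ _)
  }
  where
  none : ∀ v → length v ≡ suc k → occ v (replicate k true) ≡ 0
  none v lv = occ-short v (replicate k true) (≤-reflexive (trans (cong suc (length-replicate k)) (sym lv)))

-- Completeness of the greedy word

Complete : ℕ → Str → Set
Complete n y = ∀ v → length v ≡ n → 1 ≤ occ v y

strings : ℕ → List Str
strings zero = [] ∷ []
strings (suc n) = map (false ∷_) (strings n) ++ map (true ∷_) (strings n)

∈-strings : ∀ n v → length v ≡ n → v ∈ strings n
∈-strings zero [] e = here refl
∈-strings (suc n) (false ∷ v) e = ∈-++⁺ˡ (∈-map⁺ _ (∈-strings n v (suc-injective e)))
∈-strings (suc n) (true ∷ v) e = ∈-++⁺ʳ (map (false ∷_) (strings n)) (∈-map⁺ _ (∈-strings n v (suc-injective e)))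

strings-length : ∀ n → All (λ v → length v ≡ n) (strings n)
strings-length zero = refl ∷ []
strings-length (suc n) = AllP.++⁺ (AllP.map⁺ (All.map (cong suc) (strings-length n))) (AllP.map⁺ (All.map (cong suc) (strings-length n)))

length-strings : ∀ n → length (strings n) ≡ 2 ^ n
length-strings zero = refl
length-strings (suc n) = trans (length-++ (map (false ∷_) (strings n)))
  (cong₂ _+_ (trans (length-map (false ∷_) (strings n)) (length-strings n))
    (trans (trans (length-map (true ∷_) (strings n)) (length-strings n)) (sym (+-identityʳ _))))

∑-++ : {A : Set} (f : A → ℕ) (xs ys : List A) → ∑ f (xs ++ ys) ≡ ∑ f xs + ∑ f ys
∑-++ f [] ys = refl
∑-++ f (x ∷ xs) ys = trans (cong (f x +_) (∑-++ f xs ys)) (sym (+-assoc (f x) _ _))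

∑-map : {A B : Set} (f : B → ℕ) (g : A → B) (xs : List A) → ∑ f (map g xs) ≡ ∑ (λ a → f (g a)) xs
∑-map f g [] = refl
∑-map f g (x ∷ xs) = cong (f (g x) +_) (∑-map f g xs)

∑-strings-prefix : ∀ n z → n ≤ length z → 1 ≤ ∑ (λ v → 𝟙 (isPrefix v z)) (strings n)
∑-strings-prefix zero z le = ≤-refl
∑-strings-prefix (suc n) (b ∷ z) (s≤s le)
  rewrite ∑-++ (λ v → 𝟙 (isPrefix v (b ∷ z))) (map (false ∷_) (strings n)) (map (true ∷_) (strings n))
        | ∑-map (λ v → 𝟙 (isPrefix v (b ∷ z))) (false ∷_) (strings n)
        | ∑-map (λ v → 𝟙 (isPrefix v (b ∷ z))) (true ∷_) (strings n) with b
... | false = ≤-trans (∑-strings-prefix n z le) (m≤m+n _ _)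
... | true = ≤-trans (∑-strings-prefix n z le) (m≤n+m _ _)

-- Exchanging the sums, every suffix of length at least `n` starts with some string of length `n`;
-- at most `n` of the `suc (length y)` suffixes are shorter.
∑-strings-occ : ∀ n y → suc (length y) ≤ n + ∑ (λ v → occ v y) (strings n)
∑-strings-occ n y = ≤-trans (go y) (+-monoʳ-≤ n (≤-reflexive (sym eq)))
  where
  eq : ∑ (λ v → occ v y) (strings n) ≡ ∑ (λ z → ∑ (λ v → 𝟙 (isPrefix v z)) (strings n)) (suffixes y)
  eq = trans (cong sum (map-cong (λ v → occ-∑ v y) (strings n))) (∑-swap (λ v z → 𝟙 (isPrefix v z)) (strings n) (suffixes y))
  F = λ z → ∑ (λ v → 𝟙 (isPrefix v z)) (strings n)
  go : ∀ y → suc (length y) ≤ n + ∑ F (suffixes y)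
  go y with n ≤? length y
  go y | no nle = ≤-trans (≰⇒> nle) (m≤m+n n _)
  go [] | yes z≤n = ≤-refl
  go (a ∷ y) | yes le = ≤-trans (s≤s (go y)) (≤-trans (≤-reflexive (sym (+-suc n _)))
    (+-monoʳ-≤ n (+-monoˡ-≤ _ (∑-strings-prefix n (a ∷ y) le))))

∑-saturated : {A : Set} (f : A → ℕ) (xs : List A) → All (λ a → f a ≤ 1) xs → length xs ≤ ∑ f xs →
  ∀ {a} → a ∈ xs → 1 ≤ f a
∑-saturated f (x ∷ xs) (px ∷ pxs) le = λ { (here refl) → headCase ; (there i) → ∑-saturated f xs pxs tailCase i }
  where
  ∑≤ : ∀ xs → All (λ a → f a ≤ 1) xs → ∑ f xs ≤ length xs
  ∑≤ [] [] = z≤n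
  ∑≤ (x ∷ xs) (p ∷ ps) = +-mono-≤ p (∑≤ xs ps)
  tailCase : length xs ≤ ∑ f xs
  tailCase = s≤s⁻¹ (≤-trans le (+-monoˡ-≤ _ px))
  headCase : 1 ≤ f x
  headCase = +-cancelʳ-≤ (length xs) 1 (f x) (≤-trans le (+-monoʳ-≤ (f x) (∑≤ xs pxs)))

-- Pigeonhole: the word has 2^(k+1) windows of length k+1 and none repeats, so each of the 2^(k+1)
-- strings is used.
full→Complete : ∀ k y → Unique (suc k) y → length y ≡ k + 2 ^ suc k → Complete (suc k) y
full→Complete k y uniq len v lv =
  ∑-saturated (λ v → occ v y) (strings (suc k))
    (All.map (λ {v} → uniq v) (strings-length (suc k)))
    (subst (_≤ ∑ (λ v → occ v y) (strings (suc k))) (sym (length-strings (suc k)))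
      (+-cancelˡ-≤ (suc k) _ _ (subst (λ l → suc l ≤ suc k + ∑ (λ v → occ v y) (strings (suc k))) len (∑-strings-occ (suc k) y))))
    (∈-strings (suc k) v lv)

sum≥2 : ∀ {p q} → p ≤ 1 → q ≤ 1 → 2 ≤ p + q → 1 ≤ p × 1 ≤ q
sum≥2 {suc p} {suc q} _ _ _ = s≤s z≤n , s≤s z≤n
sum≥2 {zero} {suc q} _ (s≤s z≤n) (s≤s ())
sum≥2 {suc p} {zero} (s≤s z≤n) _ (s≤s ())

-- At a dead end e, both e0 and e1 were already used, so e occurs three times and hence has an
-- occurrence without predecessor, i.e. e = 1^k.  Then every word has at least as many
-- predecessors as successors, and "e has both successors" propagates backwards along the
-- edges that append a 1.
stuck→Complete : ∀ k y → Greedy k y → Stuck k y → Complete (suc k) y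
stuck→Complete k y g st with Greedy.tail g
... | a , e , refl , le = λ u lu → complete u lu
  where
  y′ = a ++ e
  I = replicate k true
  uniq = Greedy.unique g

  both : Str → Set
  both v = ∀ b → 1 ≤ occ (v ∷ʳ b) y′

  both-e : both e
  both-e b = extension-repeats k a e b le uniq (st b)

  in-bound : ∀ v → length v ≡ k → ∀ b → occ (b ∷ v) y′ ≤ 1
  in-bound v lv b = uniq (b ∷ v) (cong suc lv)

  prefix-I : ∀ v → length v ≡ k → isPrefix v y′ ≡ true → v ≡ I
  prefix-I v lv p = eqStr→≡ v I (trans (sym (isPrefix-eqlen v I lenI))
    (trans (sym (isPrefix-long v I r (≤-reflexive lenI))) (subst (λ y → isPrefix v y ≡ true) yI p)))
    where
    r = proj₁ (Greedy.head g)
    yI = proj₂ (Greedy.head g)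
    lenI = trans lv (sym (length-replicate k))

  e≡I : e ≡ I
  e≡I with isPrefix e y′ in eq
  ... | true = prefix-I e le eq
  ... | false = ⊥-elim (<⇒≱ (≤-trans (s≤s (+-mono-≤ (both-e false) (both-e true))) (cnt-<-occ-suffix a e))
    (≤-trans (occ-≤-predecessors e y′) (+-mono-≤ (+-mono-≤ (in-bound e le false) (in-bound e le true)) (≤-reflexive (cong 𝟙 eq)))))

  balance : ∀ v → length v ≡ k → both v → ∀ b → 1 ≤ occ (b ∷ v) y′
  balance v lv bv b with sum≥2 (in-bound v lv false) (in-bound v lv true) inDeg
    where
    inDeg : 2 ≤ occ (false ∷ v) y′ + occ (true ∷ v) y′
    inDeg with isPrefix v y′ in eq
    ... | false = ≤-trans (+-mono-≤ (bv false) (bv true)) (≤-trans (cnt-≤-occ y′ v)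
          (≤-trans (occ-≤-predecessors v y′) (≤-reflexive (trans (cong (λ q → occ (false ∷ v) y′ + occ (true ∷ v) y′ + 𝟙 q) eq) (+-identityʳ _)))))
    -- Here `v` is `e` itself. Its occurrence at the start lacks a predecessor, but its occurrence
    -- at the end lacks a successor, so the two losses cancel.
    ... | true with trans (prefix-I v lv eq) (sym e≡I)
    ... | refl = +-cancelʳ-≤ 1 2 _ (≤-trans (s≤s (+-mono-≤ (bv false) (bv true))) (≤-trans (cnt-<-occ-suffix a v)
          (≤-trans (occ-≤-predecessors v y′) (+-monoʳ-≤ _ (𝟙≤1 _)))))
  ... | p , q with b
  ... | false = p
  ... | true = q

  replicate-∷ʳ : ∀ j → replicate j true ∷ʳ true ≡ replicate (suc j) true
  replicate-∷ʳ zero = refl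
  replicate-∷ʳ (suc j) = cong (true ∷_) (replicate-∷ʳ j)

  allBoth : ∀ c j → length c + j ≡ k → both (c ++ replicate j true)
  allBoth [] j refl = subst both e≡I both-e
  allBoth (d ∷ c) j len = λ { true → via1 ; false → Greedy.prefer0 g v lv via1 }
    where
    v = d ∷ c ++ replicate j true
    lv : length v ≡ k
    lv = trans (cong suc (trans (length-++ c) (cong (length c +_) (length-replicate j)))) len
    next : c ++ replicate (suc j) true ≡ (c ++ replicate j true) ∷ʳ true
    next = trans (cong (c ++_) (sym (replicate-∷ʳ j))) (sym (++-assoc c _ _))
    ln : length (c ++ replicate (suc j) true) ≡ k
    ln = trans (length-++ c) (trans (cong (length c +_) (length-replicate (suc j))) (trans (+-suc (length c) j) len))
    via1 : 1 ≤ occ (v ∷ʳ true) y′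
    via1 = subst (λ q → 1 ≤ occ (d ∷ q) y′) next
             (balance _ ln (allBoth c (suc j) (trans (+-suc (length c) j) len)) d)

  complete : Complete (suc k) y′
  complete u lu with initLast u
  complete .[] () | []
  complete .(v ∷ʳ b) lu | v ∷ʳ′ b =
    subst both (++-identityʳ v) (allBoth v 0 (trans (+-identityʳ _) (suc-injective (trans (sym (length-∷ʳ v b)) lu)))) b

dbFull : ℕ → Str
dbFull k = dbLoop (suc k) (2 ^ suc k) (replicate k true)

dbFull-Complete : ∀ k → Complete (suc k) (dbFull k)
dbFull-Complete k with dbLoop-greedy k (2 ^ suc k) (replicate k true) (greedy-start k)
... | g , _ , inj₂ st = stuck→Complete k (dbFull k) g st
... | g , _ , inj₁ len = full→Complete k (dbFull k) (Greedy.unique g) (trans len (cong (_+ 2 ^ suc k) (length-replicate k)))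

db-Unique : ∀ k → Unique (suc k) (db (suc k))
db-Unique k v lv = ≤-trans (occ-drop-≤ v k (dbFull k))
  (Greedy.unique (proj₁ (dbLoop-greedy k (2 ^ suc k) (replicate k true) (greedy-start k))) v lv)

length-db : ∀ k → length (db (suc k)) ≤ 2 ^ suc k
length-db k rewrite length-drop k (dbFull k) =
  m≤n+o⇒m∸n≤o (length (dbFull k)) k (subst (λ l → length (dbFull k) ≤ l + 2 ^ suc k) (length-replicate k)
    (proj₁ (proj₂ (dbLoop-greedy k (2 ^ suc k) (replicate k true) (greedy-start k)))))

occ-after-ones : ∀ v k w → occ (false ∷ v) (replicate k true ++ w) ≡ occ (false ∷ v) w
occ-after-ones v zero w = refl
occ-after-ones v (suc k) w = occ-after-ones v k w

drop-ones : ∀ k (r : Str) → drop k (replicate k true ++ r) ≡ r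
drop-ones zero r = refl
drop-ones (suc k) r = drop-ones k r

-- The deleted prefix consists of 1s, so words starting with 0 survive the deletion.
db-Complete : ∀ k → Complete k (db (suc k))
db-Complete k v lv with Greedy.head (proj₁ (dbLoop-greedy k (2 ^ suc k) (replicate k true) (greedy-start k)))
... | r , eq = subst (λ w → 1 ≤ occ v w) (sym dbEq)
      (≤-trans (subst (1 ≤_) (trans (cong (occ (false ∷ v)) eq) (occ-after-ones v k r)) (dbFull-Complete k (false ∷ v) (cong suc lv)))
        (occ-++ᶜ-≤ (false ∷ []) v r))
  where
  dbEq : db (suc k) ≡ r
  dbEq = trans (cong (drop k) eq) (drop-ones k r)

-- The walk through the contexts

filterB-all : {A : Set} (p : A → Bool) (xs : List A) → All (λ a → p a ≡ true) xs → filterB p xs ≡ xs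
filterB-all p [] [] = refl
filterB-all p (x ∷ xs) (px ∷ pxs) rewrite px = cong (x ∷_) (filterB-all p xs pxs)

filterB-none : {A : Set} (p : A → Bool) (xs : List A) → All (λ a → p a ≡ false) xs → filterB p xs ≡ []
filterB-none p [] [] = refl
filterB-none p (x ∷ xs) (px ∷ pxs) rewrite px = filterB-none p xs pxs

filterB-++ : {A : Set} (p : A → Bool) (xs ys : List A) → filterB p (xs ++ ys) ≡ filterB p xs ++ filterB p ys
filterB-++ p [] ys = refl
filterB-++ p (x ∷ xs) ys with p x
... | true = cong (x ∷_) (filterB-++ p xs ys)
... | false = filterB-++ p xs ys

∈-filterB⁺ : {A : Set} (p : A → Bool) {x : A} (xs : List A) → x ∈ xs → p x ≡ true → x ∈ filterB p xs
∈-filterB⁺ p (x ∷ xs) (here refl) px rewrite px = here refl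
∈-filterB⁺ p (y ∷ xs) (there i) px with p y
... | true = there (∈-filterB⁺ p xs i px)
... | false = ∈-filterB⁺ p xs i px

∈-filterB⁻ : {A : Set} (p : A → Bool) {x : A} (xs : List A) → x ∈ filterB p xs → x ∈ xs × p x ≡ true
∈-filterB⁻ p (y ∷ xs) i with p y in eq
∈-filterB⁻ p (y ∷ xs) (here refl) | true = here refl , eq
∈-filterB⁻ p (y ∷ xs) (there i) | true = there (proj₁ (∈-filterB⁻ p xs i)) , proj₂ (∈-filterB⁻ p xs i)
... | false = there (proj₁ (∈-filterB⁻ p xs i)) , proj₂ (∈-filterB⁻ p xs i)

filterB-All : {A : Set} {Q : A → Set} (p : A → Bool) (xs : List A) → All Q xs → All Q (filterB p xs)
filterB-All p [] [] = []
filterB-All p (x ∷ xs) (q ∷ qs) with p x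
... | true = q ∷ filterB-All p xs qs
... | false = filterB-All p xs qs

filterB-AllPairs : {A : Set} {Q : A → A → Set} (p : A → Bool) (xs : List A) → AllPairs Q xs → AllPairs Q (filterB p xs)
filterB-AllPairs p [] [] = []
filterB-AllPairs p (x ∷ xs) (q ∷ qs) with p x
... | true = filterB-All p xs q ∷ filterB-AllPairs p xs qs
... | false = filterB-AllPairs p xs qs

filterB-first : {A : Set} (p : A → Bool) (xs : List A) →
  (filterB p xs ≡ [] × All (λ a → p a ≡ false) xs) ⊎
  (∃[ ys ] ∃[ k ] ∃[ zs ] ∃[ r ] xs ≡ ys ++ k ∷ zs × All (λ a → p a ≡ false) ys × p k ≡ true × filterB p xs ≡ k ∷ r)
filterB-first p [] = inj₁ (refl , [])
filterB-first p (x ∷ xs) with p x in eq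
... | true = inj₂ ([] , x , xs , filterB p xs , refl , [] , eq , refl)
... | false with filterB-first p xs
... | inj₁ (e , a) = inj₁ (e , eq ∷ a)
... | inj₂ (ys , k , zs , r , refl , a , pk , e) = inj₂ (x ∷ ys , k , zs , r , refl , eq ∷ a , pk , e)

ascending-split : ∀ ys {k zs} → AllPairs _<_ (ys ++ k ∷ zs) → All (_< k) ys × All (k <_) zs
ascending-split [] (h ∷ _) = [] , h
ascending-split (y ∷ ys) (h ∷ t) with ascending-split ys t
... | a , b = (All.head (AllP.++⁻ʳ ys h)) ∷ a , b

lastOr-∷ʳ : ∀ d xs k → lastOr d (xs ++ k ∷ []) ≡ k
lastOr-∷ʳ d [] k = refl
lastOr-∷ʳ d (x ∷ []) k = refl
lastOr-∷ʳ d (x ∷ y ∷ xs) k = lastOr-∷ʳ d (y ∷ xs) k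

suf-++ : ∀ y u → suf (y ++ u) (length u) ≡ u
suf-++ y u rewrite length-++ y {u} | m+n∸n≡m (length y) (length u) = go y
  where
  go : ∀ y → drop (length y) (y ++ u) ≡ u
  go [] = refl
  go (_ ∷ y) = go y

length-suf : ∀ x k → k ≤ length x → length (suf x k) ≡ k
length-suf x k le = trans (length-drop (length x ∸ k) x) (m∸[m∸n]≡n le)

suf-extends : ∀ x j k → j ≤ k → k ≤ length x → ∃[ e ] suf x k ≡ e ++ suf x j
suf-extends x j k j≤k k≤ = take d z , (begin
  z                       ≡⟨ take++drop≡id d z ⟨
  take d z ++ drop d z    ≡⟨ cong (take d z ++_) (drop-drop (length x ∸ k) d x) ⟩
  take d z ++ drop (length x ∸ k + d) x  ≡⟨ cong (λ q → take d z ++ drop q x) arith ⟩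
  take d z ++ suf x j ∎)
  where
  open ≡-Reasoning
  d = k ∸ j
  z = suf x k
  arith : length x ∸ k + d ≡ length x ∸ j
  arith = trans (sym (+-∸-assoc (length x ∸ k) j≤k)) (cong (_∸ j) (m∸n+n≡m k≤))

occ-suf-antitone : ∀ x z j k → j ≤ k → k ≤ length x → occ (suf x k) z ≤ occ (suf x j) z
occ-suf-antitone x z j k j≤k k≤ with suf-extends x j k j≤k k≤
... | e , eq rewrite eq = occ-++ᶜ-≤ e (suf x j) z

cnt-suf-antitone : ∀ x j k b → j ≤ k → k ≤ length x → cnt x (suf x k) b ≤ cnt x (suf x j) b
cnt-suf-antitone x j k b j≤k k≤ with suf-extends x j k j≤k k≤
... | e , eq rewrite eq | ++-assoc e (suf x j) (b ∷ []) = occ-++ᶜ-≤ e (suf x j ∷ʳ b) x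

pos≤1 : ∀ n → pos n ≤ 1
pos≤1 zero = z≤n
pos≤1 (suc n) = ≤-refl

pos-≥1 : ∀ {n} → 1 ≤ n → pos n ≡ 1
pos-≥1 (s≤s _) = refl

esc≤2 : ∀ x c → esc x c ≤ 2
esc≤2 x c = +-mono-≤ (pos≤1 (cnt x c false)) (pos≤1 (cnt x c true))

total-≤ : ∀ x c → total x c ≤ occ c x + 2
total-≤ x c = +-mono-≤ (cnt-≤-occ x c) (esc≤2 x c)

esc-both : ∀ x c → (∀ b → 1 ≤ cnt x c b) → esc x c ≡ 2
esc-both x c h rewrite pos-≥1 (h false) | pos-≥1 (h true) = refl

pos-sum-2 : ∀ p q → pos p + pos q ≢ 0 → pos p + pos q ≢ 1 → 1 ≤ p × 1 ≤ q
pos-sum-2 zero zero n0 n1 = ⊥-elim (n0 refl)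
pos-sum-2 zero (suc q) n0 n1 = ⊥-elim (n1 refl)
pos-sum-2 (suc p) zero n0 n1 = ⊥-elim (n1 refl)
pos-sum-2 (suc p) (suc q) n0 n1 = s≤s z≤n , s≤s z≤n

nondeterministic-cnt : ∀ x c → esc x c ≢ 0 → esc x c ≢ 1 → ∀ b → 1 ≤ cnt x c b
nondeterministic-cnt x c n0 n1 false = proj₁ (pos-sum-2 (cnt x c false) (cnt x c true) n0 n1)
nondeterministic-cnt x c n0 n1 true = proj₂ (pos-sum-2 (cnt x c false) (cnt x c true) n0 n1)

≡ᵇ0-false : ∀ n → n ≢ 0 → (n ≡ᵇ 0) ≡ false
≡ᵇ0-false zero ne = ⊥-elim (ne refl)
≡ᵇ0-false (suc n) ne = refl

esc-deterministic : ∀ x c b → 1 ≤ cnt x c b → cnt x c (not b) ≡ 0 → esc x c ≡ 1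
esc-deterministic x c false h e rewrite e | pos-≥1 h = refl
esc-deterministic x c true h e rewrite e | pos-≥1 h = refl

pos-sum-1 : ∀ p q → pos p + pos q ≡ 1 → 1 ≤ p → p + q + (pos p + pos q) ≡ suc p
pos-sum-1 (suc p) zero e h = trans (+-comm _ 1) (cong (λ q → suc (suc q)) (+-identityʳ p))

total-deterministic : ∀ x c b → esc x c ≡ 1 → 1 ≤ cnt x c b → total x c ≡ suc (cnt x c b)
total-deterministic x c false e h = pos-sum-1 (cnt x c false) (cnt x c true) e h
total-deterministic x c true e h =
  trans (cong₂ _+_ (+-comm (cnt x c false) _) (+-comm (pos (cnt x c false)) _))
    (pos-sum-1 (cnt x c true) (cnt x c false) (trans (+-comm (pos (cnt x c true)) _) e) h)

det : Str → ℕ → Bool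
det x k = esc x (suf x k) ≡ᵇ 1

-- Both rules for the initial context in one shape: the relevant lengths cut at the current one,
-- with nothing deterministic below. Either the cut is at a deterministic context, or there is none
-- and the cut is at the longest.
record Start (x : Str) : Set where
  field
    {below} : List ℕ
    {k} : ℕ
    {above} : List ℕ
    relevant≡ : relevant x ≡ below ++ k ∷ above
    startLen≡ : startLen x ≡ k
    below-nondet : All (λ j → esc x (suf x j) ≢ 1) below
    here-det : (esc x (suf x k) ≡ 1) ⊎ (esc x (suf x k) ≢ 1 × above ≡ [])
    below< : All (_< k) below
    above> : All (k <_) above

relevant-ascending : ∀ x → AllPairs _<_ (relevant x)
relevant-ascending x = filterB-AllPairs _ (upTo (suc (length x))) (AllPairsP.applyUpTo⁺₁ id _ (λ i<j _ → i<j))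

relevant⁺ : ∀ x k → k ≤ length x → inModel x (suf x k) ≡ true → k ∈ relevant x
relevant⁺ x k le e = ∈-filterB⁺ (λ k → inModel x (suf x k)) (upTo (suc (length x))) (∈-upTo⁺ (s≤s le)) e

relevant⁻ : ∀ x k → k ∈ relevant x → k ≤ length x × inModel x (suf x k) ≡ true
relevant⁻ x k i with ∈-filterB⁻ (λ k → inModel x (suf x k)) (upTo (suc (length x))) i
... | j , e = s≤s⁻¹ (∈-upTo⁻ j) , e

0∈relevant : ∀ x → 0 ∈ relevant x
0∈relevant x = relevant⁺ x 0 z≤n (subst (λ c → inModel x c ≡ true) (sym (trans (cong (λ y → suf y 0) (sym (++-identityʳ x))) (suf-++ x []))) refl)

nondet : ∀ x k → det x k ≡ false → esc x (suf x k) ≢ 1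
nondet x k e q rewrite q with e
... | ()

∷ʳ-view : {A : Set} {a : A} (xs : List A) → a ∈ xs → ∃[ ys ] ∃[ k ] xs ≡ ys ∷ʳ k
∷ʳ-view xs i with initLast xs
∷ʳ-view .[] () | []
∷ʳ-view .(ys ∷ʳ k) i | ys ∷ʳ′ k = ys , k , refl

start : ∀ x → Start x
start x with filterB-first (det x) (relevant x)
... | inj₂ (ys , k , zs , r , eq , a , pk , e) = record
  { relevant≡ = eq
  ; startLen≡ = lem
  ; below-nondet = All.map (λ {j} → nondet x j) a
  ; here-det = inj₁ (≡ᵇ⇒≡ _ 1 (subst Data.Bool.T (sym pk) _))
  ; below< = proj₁ (ascending-split ys (subst (AllPairs _<_) eq (relevant-ascending x)))
  ; above> = proj₂ (ascending-split ys (subst (AllPairs _<_) eq (relevant-ascending x)))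
  }
  where
  lem : startLen x ≡ k
  lem rewrite e = refl
... | inj₁ (e , a) with ∷ʳ-view (relevant x) (0∈relevant x)
... | ys , k , eq = record
  { relevant≡ = eq
  ; startLen≡ = lem
  ; below-nondet = All.map (λ {j} → nondet x j) (AllP.++⁻ˡ ys a′)
  ; here-det = inj₂ (nondet x k (All.head (AllP.++⁻ʳ ys a′)) , refl)
  ; below< = proj₁ (ascending-split ys (subst (AllPairs _<_) eq (relevant-ascending x)))
  ; above> = []
  }
  where
  a′ = subst (All (λ j → det x j ≡ false)) eq a
  lem : startLen x ≡ k
  lem rewrite e = trans (cong (lastOr 0) eq) (lastOr-∷ʳ 0 ys k)

encodeBit-walk : ∀ x b (s : Start x) → encodeBit x b ≡ walk x b (Start.k s ∷ reverse (Start.below s))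
encodeBit-walk x b s = cong (walk x b) (begin
  reverse (filterB p (relevant x))                  ≡⟨ cong (λ l → reverse (filterB p l)) relevant≡ ⟩
  reverse (filterB p (below ++ k ∷ above))          ≡⟨ cong reverse (filterB-++ p below (k ∷ above)) ⟩
  reverse (filterB p below ++ filterB p (k ∷ above)) ≡⟨ cong reverse (cong₂ _++_
      (filterB-all p below (All.map (λ j<k → ≤→p (<⇒≤ j<k)) below<)) above≡) ⟩
  reverse (below ++ k ∷ [])                         ≡⟨ reverse-++ below (k ∷ []) ⟩
  k ∷ reverse below ∎)
  where
  open ≡-Reasoning
  open Start s
  p = λ j → not (startLen x <ᵇ j)
  ≤→p : ∀ {j} → j ≤ k → p j ≡ true
  ≤→p {j} le rewrite startLen≡ with k <ᵇ j in eq
  ... | false = refl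
  ... | true = ⊥-elim (<⇒≱ (<ᵇ-true k j eq) le)
  <→p : ∀ {j} → k < j → p j ≡ false
  <→p {j} lt rewrite startLen≡ with k <ᵇ j in eq
  ... | true = refl
  ... | false = ⊥-elim (<⇒≱ lt (<ᵇ-false k j eq))
  above≡ : filterB p (k ∷ above) ≡ k ∷ []
  above≡ rewrite ≤→p {k} ≤-refl = cong (k ∷_) (filterB-none p above (All.map <→p above>))

walk-emit : ∀ x b k ks → 1 ≤ cnt x (suf x k) b →
  walk x b (k ∷ ks) ≡ (cnt x (suf x k) b , total x (suf x k))
walk-emit x b k ks h rewrite ≡ᵇ0-false (cnt x (suf x k) b) (m<n⇒n≢0 h) = refl

walk-escape : ∀ x b k ks → cnt x (suf x k) b ≡ 0 → esc x (suf x k) ≢ 0 →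
  walk x b (k ∷ ks) ≡ (esc x (suf x k) , total x (suf x k)) ⊗ walk x b ks
walk-escape x b k ks e h rewrite e | ≡ᵇ0-false (esc x (suf x k)) h = refl

inModel-esc : ∀ x c → 1 ≤ length c → inModel x c ≡ true → esc x c ≢ 0
inModel-esc x (a ∷ c) le e q rewrite q with e
... | ()

<ᵇ2-false : ∀ n → 2 ≤ n → (n <ᵇ 2) ≡ false
<ᵇ2-false (suc (suc n)) _ = refl
<ᵇ2-false (suc zero) (s≤s ())

inModel⁺ : ∀ x c → esc x c ≢ 0 → (1 ≤ length c → 2 ≤ occ (dropLast c) x) → inModel x c ≡ true
inModel⁺ x [] ne h = refl
inModel⁺ x (a ∷ c) ne h rewrite ≡ᵇ0-false (esc x (a ∷ c)) ne | <ᵇ2-false (occ (dropLast (a ∷ c)) x) (h (s≤s z≤n)) = refl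

dropLast-∷ʳ : ∀ a c → ∃[ d ] a ∷ c ≡ dropLast (a ∷ c) ∷ʳ d
dropLast-∷ʳ a [] = a , refl
dropLast-∷ʳ a (b ∷ c) with dropLast-∷ʳ b c
... | d , e = d , cong (a ∷_) e

cnt-≤-sum : ∀ x c b → cnt x c b ≤ cnt x c false + cnt x c true
cnt-≤-sum x c false = m≤m+n _ _
cnt-≤-sum x c true = m≤n+m _ _

occ-dropLast : ∀ x c → 1 ≤ length c → occ c x ≤ occ (dropLast c) x
occ-dropLast x (a ∷ c) _ with dropLast-∷ʳ a c
... | d , e = ≤-trans (≤-trans (≤-reflexive (cong (λ q → occ q x) e)) (cnt-≤-sum x (dropLast (a ∷ c)) d)) (cnt-≤-occ x (dropLast (a ∷ c)))

-- The cost of a bit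

-- Besides its occurrences with a continuation, `u` occurs at the end of the text, hence twice, and
-- so does `dropLast u`; this puts `u` in the model. The shortest deterministic context is then a
-- suffix of `u`, counts `b` at least as often, and N/(N+1) grows with the count N.
deterministic-bit : ∀ y u b j → 1 ≤ j → j ≤ cnt (y ++ u) u b → cnt (y ++ u) u (not b) ≡ 0 →
  let p = encodeBit (y ++ u) b in proj₂ p * j ≤ suc j * proj₁ p
deterministic-bit y u b j 1≤j j≤ none = subst (λ p → proj₂ p * j ≤ suc j * proj₁ p) (sym enc)
    (≤-trans (≤-reflexive (cong (_* j) (total-deterministic x (suf x k) b det-k 1≤N))) *-≤)
  where
  x = y ++ u
  R = length u
  open Start (start x)
  N = cnt x (suf x k) b
  sufR : suf x R ≡ u
  sufR = suf-++ y u
  R≤ : R ≤ length x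
  R≤ = subst (R ≤_) (sym (length-++ y)) (m≤n+m R (length y))
  det-u : esc x u ≡ 1
  det-u = esc-deterministic x u b (≤-trans 1≤j j≤) none
  R∈ : R ∈ relevant x
  R∈ = relevant⁺ x R R≤ (subst (λ c → inModel x c ≡ true) (sym sufR)
    (inModel⁺ x u (λ q → contradiction (trans (sym det-u) q) λ ())
      (λ le → ≤-trans (≤-trans (s≤s (≤-trans (≤-trans 1≤j j≤) (cnt-≤-sum x u b))) (cnt-<-occ-suffix y u)) (occ-dropLast x u le))))
  det-R : esc x (suf x R) ≡ 1
  det-R = trans (cong (esc x) sufR) det-u
  position : k ≤ R × esc x (suf x k) ≡ 1
  position with ∈-++⁻ below (subst (R ∈_) relevant≡ R∈) | here-det
  ... | inj₁ i | _ = ⊥-elim (All.lookup below-nondet i det-R)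
  ... | inj₂ (here e) | inj₁ d = ≤-reflexive (sym e) , d
  ... | inj₂ (there i) | inj₁ d = <⇒≤ (All.lookup above> i) , d
  ... | inj₂ (here e) | inj₂ (nd , _) = ⊥-elim (nd (subst (λ q → esc x (suf x q) ≡ 1) e det-R))
  ... | inj₂ (there i) | inj₂ (_ , ab) with subst (R ∈_) ab i
  ... | ()
  det-k = proj₂ position
  j≤N : j ≤ N
  j≤N = ≤-trans (subst (λ c → j ≤ cnt x c b) (sym sufR) j≤) (cnt-suf-antitone x k R b (proj₁ position) R≤)
  1≤N = ≤-trans 1≤j j≤N
  enc : encodeBit x b ≡ (N , total x (suf x k))
  enc = trans (encodeBit-walk x b (start x)) (walk-emit x b k (reverse below) 1≤N)
  *-≤ : suc N * j ≤ suc j * N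
  *-≤ = +-mono-≤ j≤N (≤-reflexive (*-comm N j))

module Crude (m : ℕ) (x : Str) (C : Complete (suc m) x) where
  extend : ∀ c b → length c ≤ m → 1 ≤ cnt x c b
  extend c b le with occ→split ((c ∷ʳ b) ++ replicate (m ∸ length c) true) x (C ((c ∷ʳ b) ++ replicate (m ∸ length c) true) len)
    where
    len : length ((c ∷ʳ b) ++ replicate (m ∸ length c) true) ≡ suc m
    len = trans (length-++ (c ∷ʳ b)) (trans (cong₂ _+_ (length-∷ʳ c b) (length-replicate (m ∸ length c))) (cong suc (m+[n∸m]≡n le)))
  ... | a , s , eq = subst (λ z → 1 ≤ occ (c ∷ʳ b) z) (sym (trans eq (cong (a ++_) (++-assoc (c ∷ʳ b) _ s)))) (occ-middle (c ∷ʳ b) a _)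

  m≤length : m ≤ length x
  m≤length with suc m ≤? length x
  ... | yes le = <⇒≤ le
  ... | no nle = ⊥-elim (<⇒≱ (C (replicate (suc m) true) (length-replicate (suc m)))
          (≤-reflexive (occ-short (replicate (suc m) true) x (subst (length x <_) (sym (length-replicate (suc m))) (≰⇒> nle)))))

  esc-short : ∀ c → length c ≤ m → esc x c ≡ 2
  esc-short c le = esc-both x c (λ b → extend c b le)

  m∈relevant : m ∈ relevant x
  m∈relevant = relevant⁺ x m m≤length (inModel⁺ x c (λ q → contradiction (trans (sym e2) q) λ ())
    (λ _ → ≤-trans (+-mono-≤ (extend (dropLast c) false short) (extend (dropLast c) true short)) (cnt-≤-occ x (dropLast c))))
    where
    c = suf x m
    lc = length-suf x m m≤length
    e2 = esc-short c (≤-reflexive lc)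
    length-dropLast : ∀ c → length (dropLast c) ≤ length c
    length-dropLast [] = z≤n
    length-dropLast (a ∷ []) = z≤n
    length-dropLast (a ∷ b ∷ c) = s≤s (length-dropLast (b ∷ c))
    short : length (dropLast c) ≤ m
    short = ≤-trans (length-dropLast c) (≤-reflexive lc)

  -- The empty context belongs to the model unconditionally, so its case rests on completeness
  -- instead of on membership.
  esc≢0 : ∀ k → k ∈ relevant x → esc x (suf x k) ≢ 0
  esc≢0 zero i q = contradiction (trans (sym (esc-short (suf x 0) (subst (_≤ m) (sym (length-suf x 0 z≤n)) z≤n))) q) λ ()
  esc≢0 (suc k) i = inModel-esc x (suf x (suc k)) (subst (1 ≤_) (sym (length-suf x (suc k) (proj₁ r))) (s≤s z≤n)) (proj₂ r)
    where r = relevant⁻ x (suc k) i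

  open Start (start x)

  T : ℕ
  T = occ (suf x m) x + 2

  total-T : ∀ j → m ≤ j → j ≤ length x → total x (suf x j) ≤ T
  total-T j le le′ = ≤-trans (total-≤ x (suf x j)) (+-monoˡ-≤ 2 (occ-suf-antitone x x m j le le′))

  k∈ : k ∈ relevant x
  k∈ = subst (k ∈_) (sym relevant≡) (∈-++⁺ʳ below (here refl))

  k≤ : k ≤ length x
  k≤ = proj₁ (relevant⁻ x k k∈)

  m∈below : esc x (suf x k) ≡ 1 → m ∈ below
  m∈below d with ∈-++⁻ below (subst (m ∈_) relevant≡ m∈relevant)
  ... | inj₁ i = i
  ... | inj₂ i = contradiction (trans (sym d) (esc-short (suf x k) (≤-trans (≤-reflexive (length-suf x k k≤)) (k≤m i)))) λ ()
    where
    k≤m : m ∈ k ∷ above → k ≤ m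
    k≤m (here e) = ≤-reflexive (sym e)
    k≤m (there i) = <⇒≤ (All.lookup above> i)

  m≤k : m ≤ k
  m≤k with ∈-++⁻ below (subst (m ∈_) relevant≡ m∈relevant) | here-det
  ... | inj₁ i | _ = <⇒≤ (All.lookup below< i)
  ... | inj₂ (here e) | _ = ≤-reflexive e
  ... | inj₂ (there i) | inj₁ d = <⇒≤ (All.lookup below< (m∈below d))
  ... | inj₂ (there i) | inj₂ (_ , ab) with subst (m ∈_) ab i
  ... | ()

  -- Below the shortest deterministic context every relevant context predicts both bits, so
  -- there is at most one escape.
  crude-bit : ∀ b → let p = encodeBit x b in 1 ≤ proj₁ p × proj₂ p ≤ T * T
  crude-bit b rewrite encodeBit-walk x b (start x) with 1 ≤? cnt x (suf x k) b
  ... | yes h = subst Bound (sym (walk-emit x b k (reverse below) h))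
          (h , ≤-trans (total-T k m≤k k≤) (m≤m*n T T ⦃ >-nonZero (≤-trans (s≤s z≤n) (m≤n+m 2 (occ (suf x m) x))) ⦄))
    where
    Bound = λ (p : Prob) → 1 ≤ proj₁ p × proj₂ p ≤ T * T
  ... | no nh with here-det
  ... | inj₂ (nd , _) = ⊥-elim (nh (nondeterministic-cnt x (suf x k) (esc≢0 k k∈) nd b))
  ... | inj₁ d with ∷ʳ-view below (m∈below d)
  ... | ys , k₁ , eq = subst Bound (sym enc)
          (*-mono-≤ (≤-reflexive (sym d)) pos₁ , *-mono-≤ (total-T k m≤k k≤) (total-T k₁ m≤k₁ k₁≤))
    where
    Bound = λ (p : Prob) → 1 ≤ proj₁ p × proj₂ p ≤ T * T
    k₁∈below : k₁ ∈ below
    k₁∈below = subst (k₁ ∈_) (sym eq) (∈-++⁺ʳ ys (here refl))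
    k₁∈ : k₁ ∈ relevant x
    k₁∈ = subst (k₁ ∈_) (sym relevant≡) (∈-++⁺ˡ k₁∈below)
    k₁≤ = proj₁ (relevant⁻ x k₁ k₁∈)
    pos₁ : 1 ≤ cnt x (suf x k₁) b
    pos₁ = nondeterministic-cnt x (suf x k₁) (esc≢0 k₁ k₁∈) (All.lookup below-nondet k₁∈below) b
    m≤k₁ : m ≤ k₁
    m≤k₁ with ∈-++⁻ ys (subst (m ∈_) eq (m∈below d))
    ... | inj₂ (here e) = ≤-reflexive e
    ... | inj₁ i = <⇒≤ (All.lookup (proj₁ (ascending-split ys asc)) i)
      where
      asc : AllPairs _<_ (ys ++ k₁ ∷ k ∷ above)
      asc = subst (AllPairs _<_) (trans relevant≡ (trans (cong (_++ k ∷ above) eq) (++-assoc ys (k₁ ∷ []) _))) (relevant-ascending x)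
    enc : walk x b (k ∷ reverse below) ≡ (esc x (suf x k) , total x (suf x k)) ⊗ (cnt x (suf x k₁) b , total x (suf x k₁))
    enc = trans (walk-escape x b k (reverse below) (n<1⇒n≡0 (≰⇒> nh)) (λ q → contradiction (trans (sym d) q) λ ()))
      (cong ((esc x (suf x k) , total x (suf x k)) ⊗_)
        (trans (cong (walk x b) (trans (cong reverse eq) (reverse-++ ys (k₁ ∷ [])))) (walk-emit x b k₁ (reverse ys) pos₁)))

-- Costs of segments and double counting of windows

*-interchange : ∀ a b c d → (a * b) * (c * d) ≡ (a * c) * (b * d)
*-interchange = solve-∀

-- With `p` = (numerator, denominator) this says that 1/p is at most α/β, i.e. that the cost is at
-- most log α - log β.
Cost : ℕ → ℕ → Prob → Set
Cost α β p = proj₂ p * β ≤ α * proj₁ p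

cost-⊗ : ∀ {α β α′ β′} p q → Cost α β p → Cost α′ β′ q → Cost (α * α′) (β * β′) (p ⊗ q)
cost-⊗ {α} {β} {α′} {β′} (a , b) (c , d) h h′ = begin
  (b * d) * (β * β′)   ≡⟨ *-interchange b d β β′ ⟩
  (b * β) * (d * β′)   ≤⟨ *-mono-≤ h h′ ⟩
  (α * a) * (α′ * c)   ≡⟨ *-interchange α a α′ c ⟩
  (α * α′) * (a * c)   ∎
  where open ≤-Reasoning

cost-mono : ∀ {α β α′} p → α ≤ α′ → Cost α β p → Cost α′ β p
cost-mono p le h = ≤-trans h (*-monoˡ-≤ (proj₁ p) le)

cost-pad : ∀ {α β} γ δ p → δ ≤ γ → Cost α β p → Cost (α * γ) (β * δ) p
cost-pad {α} {β} γ δ (a , b) le h = begin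
  b * (β * δ)  ≡⟨ *-assoc b β δ ⟨
  b * β * δ    ≤⟨ *-mono-≤ h le ⟩
  α * a * γ    ≡⟨ swap α a γ ⟩
  α * γ * a    ∎
  where
  open ≤-Reasoning
  swap : ∀ α a γ → α * a * γ ≡ α * γ * a
  swap = solve-∀

encodeSeq-++ : ∀ x y z → encodeSeq x (y ++ z) ≡ encodeSeq x y ⊗ encodeSeq (x ++ y) z
encodeSeq-++ x [] z rewrite ++-identityʳ x = cong₂ _,_ (sym (*-identityˡ _)) (sym (*-identityˡ _))
encodeSeq-++ x (b ∷ y) z rewrite encodeSeq-++ (x ∷ʳ b) y z | ++-assoc x (b ∷ []) y =
  cong₂ _,_ (sym (*-assoc (proj₁ (encodeBit x b)) _ _)) (sym (*-assoc (proj₂ (encodeBit x b)) _ _))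

cost-++ : ∀ {α β α′ β′} x y z → Cost α β (encodeSeq x y) → Cost α′ β′ (encodeSeq (x ++ y) z) →
  Cost (α * α′) (β * β′) (encodeSeq x (y ++ z))
cost-++ {α} {β} {α′} {β′} x y z h h′ = subst (Cost (α * α′) (β * β′)) (sym (encodeSeq-++ x y z))
  (cost-⊗ {α} {β} {α′} {β′} (encodeSeq x y) (encodeSeq (x ++ y) z) h h′)

after′ : (Str → Bool → ℕ) → Str → Str → ℕ
after′ f u [] = 0
after′ f u (b ∷ _) = f u b

after : ℕ → (Str → Bool → ℕ) → Str → ℕ
after H f z = after′ f (take H z) (drop H z)

after-drop : ∀ H f z {b r} → drop H z ≡ b ∷ r → after H f z ≡ f (take H z) b
after-drop H f z e rewrite e = refl

take-drop-step : ∀ H (z : Str) {b r} → drop H z ≡ b ∷ r → take H z ∷ʳ b ≡ take (suc H) z × drop (suc H) z ≡ r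
take-drop-step zero (d ∷ z) refl = refl , refl
take-drop-step (suc H) (d ∷ z) e with take-drop-step H z e
... | p , q = cong (d ∷_) p , q

length-take-exact : ∀ H (z : Str) {b r} → drop H z ≡ b ∷ r → length (take H z) ≡ H
length-take-exact zero z e = refl
length-take-exact (suc H) (d ∷ z) e = cong suc (length-take-exact H z e)

-- The window before a bit is `take H z` for a suffix `z` of the word, so the surplus exponents `e`
-- are indexed by suffixes, which is the form that double counting takes up. `Q` carries what is
-- known about the text `y` in front of the window while bits move from `z` to `y`.
window-seq : (H : ℕ) (e : Str → ℕ) (A B : ℕ) (Q : Str → Str → Set) →
  (∀ y d z → Q y (d ∷ z) → Q (y ∷ʳ d) z) →
  (∀ y z b r → drop H z ≡ b ∷ r → Q y z → Cost (2 ^ e z * A) B (encodeBit (y ++ take H z) b)) →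
  ∀ z y → Q y z →
  Cost (2 ^ ∑ e (suffixes z) * A ^ length (drop H z)) (B ^ length (drop H z)) (encodeSeq (y ++ take H z) (drop H z))
window-seq H e A B Q step bit z y q with drop H z in eq
... | [] = *-monoˡ-≤ 1 (*-monoˡ-≤ 1 (m^n>0 2 (∑ e (suffixes z))))
window-seq (suc H) e A B Q step bit [] y q | b ∷ r with eq
... | ()
window-seq zero e A B Q step bit [] y q | b ∷ r with eq
... | ()
window-seq H e A B Q step bit (d ∷ z) y q | b ∷ r with take-drop-step H (d ∷ z) eq
... | p₁ , refl = subst₂ (λ α p → Cost α (B * B ^ length (drop H z)) p) arith (cong (encodeBit (y ++ take H (d ∷ z)) b ⊗_) (cong (λ x → encodeSeq x (drop H z)) assoc))
    (cost-⊗ {2 ^ e (d ∷ z) * A} {B} {2 ^ ∑ e (suffixes z) * A ^ length (drop H z)} {B ^ length (drop H z)}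
      (encodeBit (y ++ take H (d ∷ z)) b) (encodeSeq ((y ∷ʳ d) ++ take H z) (drop H z))
      (bit y (d ∷ z) b (drop H z) eq q) (window-seq H e A B Q step bit z (y ∷ʳ d) (step y d z q)))
  where
  arith : (2 ^ e (d ∷ z) * A) * (2 ^ ∑ e (suffixes z) * A ^ length (drop H z)) ≡ 2 ^ (e (d ∷ z) + ∑ e (suffixes z)) * (A * A ^ length (drop H z))
  arith = trans (*-interchange (2 ^ e (d ∷ z)) A _ _) (cong (_* (A * A ^ length (drop H z))) (sym (^-distribˡ-+-* 2 (e (d ∷ z)) _)))
  assoc : (y ∷ʳ d) ++ take H z ≡ (y ++ take H (d ∷ z)) ∷ʳ b
  assoc = trans (++-assoc y (d ∷ []) (take H z)) (trans (cong (y ++_) (sym p₁)) (sym (++-assoc y (take H (d ∷ z)) _)))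

∈-suffixes : ∀ {z} w → z ∈ suffixes w → ∃[ h ] w ≡ h ++ z
∈-suffixes [] (here refl) = [] , refl
∈-suffixes (a ∷ w) (here refl) = [] , refl
∈-suffixes (a ∷ w) (there i) with ∈-suffixes w i
... | h , e = a ∷ h , cong (a ∷_) e

∑-witness : {A : Set} (f : A → ℕ) (xs : List A) → 1 ≤ ∑ f xs → ∃[ a ] a ∈ xs × 1 ≤ f a
∑-witness f (x ∷ xs) h with f x in eq
... | suc k = x , here refl , subst (1 ≤_) (sym eq) (s≤s z≤n)
... | zero with ∑-witness f xs h
... | a , i , le = a , there i , le

++-prefix-≤ : ∀ (a c : Str) {b e : Str} → a ++ b ≡ c ++ e → length a ≤ length c → ∃[ f ] c ≡ a ++ f
++-prefix-≤ [] c eq le = c , refl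
++-prefix-≤ (x ∷ a) (y ∷ c) eq (s≤s le) with ∷-injective eq
... | refl , eq′ with ++-prefix-≤ a c eq′ le
... | f , e = f , cong (x ∷_) e

take-prefix : ∀ κ (u s : Str) → κ ≤ length u → take κ (u ++ s) ≡ take κ u
take-prefix zero u s le = refl
take-prefix (suc κ) (a ∷ u) s (s≤s le) = cong (a ∷_) (take-prefix κ u s le)

take-take-≤ : ∀ κ H (z : Str) → κ ≤ H → take κ (take H z) ≡ take κ z
take-take-≤ zero H z le = refl
take-take-≤ (suc κ) (suc H) [] le = refl
take-take-≤ (suc κ) (suc H) (a ∷ z) (s≤s le) = cong (a ∷_) (take-take-≤ κ H z le)

isPrefix-takeˡ : ∀ κ (z : Str) → isPrefix (take κ z) z ≡ true
isPrefix-takeˡ κ z = subst (λ x → isPrefix (take κ z) x ≡ true) (take++drop≡id κ z) (isPrefix-++ (take κ z) (drop κ z))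

-- Set-up for double counting: `z` runs over the positions of `w`, `q` over those of the text. A hit
-- means that the text at `q` shows the `H`-window of `z` followed by `t b`; this is a plain
-- occurrence for empty `t b` and a wrong continuation for `not b`.
module Hits (H κ : ℕ) (κ≤H : κ ≤ H) (t : Bool → Str) where
  hit : Str → Str → ℕ
  hit q = after H (λ u b → 𝟙 (isPrefix (u ++ t b) q))

  hit≤1 : ∀ q z → hit q z ≤ 1
  hit≤1 q z with drop H z
  ... | [] = z≤n
  ... | b ∷ r = 𝟙≤1 (isPrefix (take H z ++ t b) q)

  hit→ : ∀ q z → 1 ≤ hit q z → ∃[ b ] ∃[ r ] ∃[ s ] drop H z ≡ b ∷ r × q ≡ take H z ++ t b ++ s
  hit→ q z h with drop H z
  ... | b ∷ r with isPrefix (take H z ++ t b) q in eq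
  ... | true with isPrefix→++ (take H z ++ t b) q eq
  ... | s , e = b , r , s , refl , trans e (++-assoc (take H z) (t b) s)

  hit-≤ : ∀ q z → hit q z ≤ 𝟙 (isPrefix (take κ q) z)
  hit-≤ q z with 1 ≤? hit q z
  ... | no nh = ≤-trans (s≤s⁻¹ (≰⇒> nh)) z≤n
  ... | yes h with hit→ q z h
  ... | b , r , s , e , refl =
    subst (λ v → hit q z ≤ 𝟙 (isPrefix v z))
      (sym (trans (take-prefix κ (take H z) (t b ++ s) (subst (κ ≤_) (sym (length-take-exact H z e)) κ≤H)) (take-take-≤ κ H z κ≤H)))
      (subst (λ c → hit q z ≤ 𝟙 c) (sym (isPrefix-takeˡ κ z)) (hit≤1 q z))

  module _ (w : Str) where
    hits : Str → ℕ
    hits q = ∑ (hit q) (suffixes w)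

    -- All `z` that hit `q` start with the same κ bits, those of `q`, so they are occurrences in `w`
    -- of one word. The case without hits is separate because `q` may then be shorter than κ.
    hits-≤ : ∀ M → (∀ v → length v ≡ κ → occ v w ≤ M) → ∀ q → hits q ≤ M
    hits-≤ M bound q with 1 ≤? hits q
    ... | no nh = ≤-trans (s≤s⁻¹ (≰⇒> nh)) z≤n
    ... | yes h with ∑-witness (hit q) (suffixes w) h
    ... | z , _ , hz with hit→ q z hz
    ... | b , r , s , e , q≡ = ≤-trans (∑-mono (suffixes w) (hit-≤ q))
        (≤-trans (≤-reflexive (sym (occ-∑ (take κ q) w))) (bound (take κ q) (trans (length-take κ q) (m≤n⇒m⊓n≡m κ≤))))
      where
      κ≤ : κ ≤ length q
      κ≤ = ≤-trans (subst (κ ≤_) (sym (length-take-exact H z e)) κ≤H)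
        (subst (length (take H z) ≤_) (sym (trans (cong length q≡) (length-++ (take H z)))) (m≤m+n _ _))

    occ-sum : ∀ X → ∑ (after H (λ u b → occ (u ++ t b) X)) (suffixes w) ≡ ∑ hits (suffixes X)
    occ-sum X = trans (cong sum (map-cong pointwise (suffixes w))) (∑-swap (λ z q → hit q z) (suffixes w) (suffixes X))
      where
      pointwise : ∀ z → after H (λ u b → occ (u ++ t b) X) z ≡ ∑ (λ q → hit q z) (suffixes X)
      pointwise z with drop H z
      ... | [] = sym (∑-0 (suffixes X))
      ... | b ∷ r = occ-∑ (take H z ++ t b) X

module Wrong (n D : ℕ) (w : Str) (U : Unique n w) where
  open Hits (n + D) n (m≤m+n n D) (λ b → not b ∷ []) public

  -- Let `s₀` be the last `n` bits of the window that hits `q`. In `w` it is followed by `b`, in the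
  -- text at `q` by `not b`. For 1 ≤ d ≤ D the window hitting `drop d q` covers `s₀` together with
  -- this wrong bit, and it is also a factor of `w`; so `s₀` occurs twice in `w`.
  sparse : ∀ q d → 1 ≤ d → d ≤ D → 1 ≤ hits w q → hits w (drop d q) ≡ 0
  sparse q d 1≤d d≤D h with 1 ≤? hits w (drop d q)
  ... | no nh = n<1⇒n≡0 (≰⇒> nh)
  ... | yes h′ with ∑-witness (hit q) (suffixes w) h | ∑-witness (hit (drop d q)) (suffixes w) h′
  ... | z , z∈ , hz | z′ , z′∈ , hz′ with hit→ q z hz | hit→ (drop d q) z′ hz′ | ∈-suffixes w z∈ | ∈-suffixes w z′∈
  ... | b , r , s , e , q≡ | b′ , r′ , s′ , e′ , q′≡ | a , w≡ | a′ , w′≡ =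
    ⊥-elim (<⇒≱ (s≤s (U s₀ len-s₀)) (≤-trans (two b right wrong) (cnt-≤-occ w s₀)))
    where
    R = n + D
    u = take R z
    u₁ = take D u
    s₀ = drop D u
    len-u : length u ≡ R
    len-u = length-take-exact R z e
    len-u₁ : length u₁ ≡ D
    len-u₁ = trans (length-take D u) (m≤n⇒m⊓n≡m (subst (D ≤_) (sym len-u) (m≤n+m D n)))
    len-s₀ : length s₀ ≡ n
    len-s₀ = trans (length-drop D u) (trans (cong (_∸ D) len-u) (m+n∸n≡m n D))
    split : u ≡ u₁ ++ s₀
    split = sym (take++drop≡id D u)
    right : 1 ≤ occ (s₀ ∷ʳ b) w
    right = subst (λ x → 1 ≤ occ (s₀ ∷ʳ b) x) (sym eq) (occ-middle (s₀ ∷ʳ b) (a ++ u₁) r)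
      where
      open ≡-Reasoning
      eq : w ≡ (a ++ u₁) ++ (s₀ ∷ʳ b) ++ r
      eq = begin
        w                              ≡⟨ w≡ ⟩
        a ++ z                         ≡⟨ cong (a ++_) (sym (take++drop≡id R z)) ⟩
        a ++ (u ++ drop R z)           ≡⟨ cong (λ k → a ++ (u ++ k)) e ⟩
        a ++ (u ++ b ∷ r)              ≡⟨ cong (λ k → a ++ (k ++ b ∷ r)) split ⟩
        a ++ ((u₁ ++ s₀) ++ b ∷ r)     ≡⟨ cong (a ++_) (++-assoc u₁ s₀ (b ∷ r)) ⟩
        a ++ (u₁ ++ (s₀ ++ b ∷ r))     ≡⟨ ++-assoc a u₁ _ ⟨
        (a ++ u₁) ++ (s₀ ++ b ∷ r)     ≡⟨ cong ((a ++ u₁) ++_) (++-assoc s₀ (b ∷ []) r) ⟨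
        (a ++ u₁) ++ (s₀ ∷ʳ b) ++ r    ∎
    p = drop d u₁ ++ (s₀ ∷ʳ not b)
    dropped : drop d q ≡ p ++ s
    dropped = begin
        drop d q                                   ≡⟨ cong (drop d) q≡ ⟩
        drop d (u ++ not b ∷ s)                    ≡⟨ cong (λ k → drop d (k ++ not b ∷ s)) split ⟩
        drop d ((u₁ ++ s₀) ++ not b ∷ s)           ≡⟨ cong (drop d) (++-assoc u₁ s₀ _) ⟩
        drop d (u₁ ++ (s₀ ++ not b ∷ s))           ≡⟨ drop-++-≤ d u₁ (subst (d ≤_) (sym len-u₁) d≤D) ⟩
        drop d u₁ ++ (s₀ ++ not b ∷ s)             ≡⟨ cong (drop d u₁ ++_) (++-assoc s₀ (not b ∷ []) s) ⟨
        drop d u₁ ++ ((s₀ ∷ʳ not b) ++ s)          ≡⟨ ++-assoc (drop d u₁) (s₀ ∷ʳ not b) s ⟨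
        p ++ s ∎
      where
      open ≡-Reasoning
      drop-++-≤ : ∀ d (x : Str) {y} → d ≤ length x → drop d (x ++ y) ≡ drop d x ++ y
      drop-++-≤ zero x le = refl
      drop-++-≤ (suc d) (_ ∷ x) (s≤s le) = drop-++-≤ d x le
    len-p : length p ≤ length (take R z′)
    len-p = begin
        length p                       ≡⟨ length-++ (drop d u₁) ⟩
        length (drop d u₁) + length (s₀ ∷ʳ not b) ≡⟨ cong₂ _+_ (trans (length-drop d u₁) (cong (_∸ d) len-u₁)) (trans (length-∷ʳ s₀ (not b)) (cong suc len-s₀)) ⟩
        (D ∸ d) + suc n                ≡⟨ +-suc (D ∸ d) n ⟩
        suc (D ∸ d) + n                ≤⟨ +-monoˡ-≤ n (≤-trans (+-monoˡ-≤ (D ∸ d) 1≤d) (≤-reflexive (m+[n∸m]≡n d≤D))) ⟩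
        D + n                          ≡⟨ +-comm D n ⟩
        R                              ≡⟨ length-take-exact R z′ e′ ⟨
        length (take R z′) ∎
      where open ≤-Reasoning
    wrong : 1 ≤ occ (s₀ ∷ʳ not b) w
    wrong with ++-prefix-≤ p (take R z′) (trans (sym dropped) q′≡) len-p
    ... | f , f≡ = ≤-trans (subst (λ x → 1 ≤ occ (s₀ ∷ʳ not b) x) (sym (trans f≡ (++-assoc (drop d u₁) (s₀ ∷ʳ not b) f))) (occ-middle (s₀ ∷ʳ not b) (drop d u₁) f))
      (≤-trans (occ-++ˡ-≤ (s₀ ∷ʳ not b) (take R z′) (drop R z′))
      (≤-trans (≤-reflexive (cong (occ (s₀ ∷ʳ not b)) (take++drop≡id R z′)))
      (≤-trans (occ-++ʳ-≤ (s₀ ∷ʳ not b) a′ z′) (≤-reflexive (cong (occ (s₀ ∷ʳ not b)) (sym w′≡))))))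
    two : ∀ b → 1 ≤ occ (s₀ ∷ʳ b) w → 1 ≤ occ (s₀ ∷ʳ not b) w → 2 ≤ cnt w s₀ false + cnt w s₀ true
    two true p q = +-mono-≤ q p
    two false p q = +-mono-≤ p q

  -- Amortization: a hit pays with itself and the `D` positions after it, and `k` counts those still
  -- blocked by the latest hit. The final `suc D` covers a hit too near the end to be paid in full.
  sparse-count : ∀ q k → (∀ d → d < k → hits w (drop d q) ≡ 0) → k ≤ D →
    suc D * ∑ (hits w) (suffixes q) + k ≤ length q + suc D
  sparse-count [] zero free le = ≤-trans (≤-reflexive (+-identityʳ _))
    (≤-trans (*-monoʳ-≤ (suc D) (+-monoˡ-≤ 0 (hits-≤ w 1 U []))) (≤-reflexive (*-identityʳ _)))
  sparse-count [] (suc k) free le rewrite free 0 (s≤s z≤n) | *-zeroʳ D = m≤n⇒m≤1+n le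
  sparse-count (a ∷ q) (suc k) free le rewrite free 0 (s≤s z≤n) =
    ≤-trans (≤-reflexive (+-suc _ k)) (s≤s (sparse-count q k (λ d lt → free (suc d) (s≤s lt)) (<⇒≤ le)))
  sparse-count (a ∷ q) zero free le with hits w (a ∷ q) in eq | hits-≤ w 1 U (a ∷ q)
  ... | zero | _ = m≤n⇒m≤1+n (sparse-count q 0 (λ d ()) z≤n)
  ... | suc zero | _ = begin
      suc D * suc S + 0        ≡⟨ arith D S ⟩
      suc (suc D * S + D)      ≤⟨ s≤s (sparse-count q D (λ d lt → sparse (a ∷ q) (suc d) (s≤s z≤n) lt (≤-reflexive (sym eq))) ≤-refl) ⟩
      suc (length q + suc D) ∎
    where
    open ≤-Reasoning
    S = ∑ (hits w) (suffixes q)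
    arith : ∀ D S → suc D * suc S + 0 ≡ suc (suc D * S + D)
    arith = solve-∀
  ... | suc (suc _) | s≤s ()

  wrong-sum : ∀ X → suc D * ∑ (after (n + D) (λ u b → occ (u ∷ʳ not b) X)) (suffixes w) ≤ length X + suc D
  wrong-sum X rewrite occ-sum w X = ≤-trans (m≤m+n _ 0) (sparse-count X 0 (λ d ()) z≤n)

-- The cost of a block of rotations

Complete-++ : ∀ k x y → Complete k x → Complete k (x ++ y)
Complete-++ k x y C v lv = ≤-trans (C v lv) (occ-++ˡ-≤ v x y)

cost-one : ∀ K p → 1 ≤ proj₁ p → proj₂ p ≤ K → Cost K 1 p
cost-one K (a , b) h le = ≤-trans (≤-reflexive (*-identityʳ b)) (≤-trans le (m≤m*n K a ⦃ >-nonZero h ⦄))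

cost-cancel : ∀ {α β} γ p → 1 ≤ γ → Cost (α * γ) (β * γ) p → Cost α β p
cost-cancel {α} {β} γ (a , b) h le = *-cancelʳ-≤ (b * β) (α * a) γ ⦃ >-nonZero h ⦄
  (≤-trans (≤-reflexive (*-assoc b β γ)) (≤-trans le (≤-reflexive (swap α γ a))))
  where
  swap : ∀ α γ a → α * γ * a ≡ α * a * γ
  swap = solve-∀

suc≤2^ : ∀ q → suc q ≤ 2 ^ q
suc≤2^ zero = ≤-refl
suc≤2^ (suc q) = ≤-trans (+-mono-≤ (m^n>0 2 q) (suc≤2^ q)) (≤-reflexive (cong (2 ^ q +_) (sym (+-identityʳ _))))

-- A linear upper bound for log T in disguise, from q + 1 ≤ 2^q. It serves for the occurrence counts
-- and, with divisor 8, for comparing n^8 with 2^n.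
≤-*-2^-quotient : ∀ T n .⦃ _ : NonZero n ⦄ → T ≤ n * 2 ^ (T / n)
≤-*-2^-quotient T n = begin
  T                     ≡⟨ m≡m%n+[m/n]*n T n ⟩
  T % n + (T / n) * n   ≤⟨ +-monoˡ-≤ _ (<⇒≤ (m%n<n T n)) ⟩
  n + (T / n) * n       ≡⟨ *-comm n (suc (T / n)) ⟨
  n * suc (T / n)       ≤⟨ *-monoʳ-≤ n (suc≤2^ (T / n)) ⟩
  n * 2 ^ (T / n) ∎
  where open ≤-Reasoning

*-^ : ∀ k a b → (a * b) ^ k ≡ a ^ k * b ^ k
*-^ zero a b = refl
*-^ (suc k) a b = trans (cong (a * b *_) (*-^ k a b)) (*-interchange a b (a ^ k) (b ^ k))

Unique-drop : ∀ {n} w k → (∀ v → length v ≡ suc k → occ v w ≤ n) → ∀ v → length v ≡ k → occ v w ≤ suc (n + n)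
Unique-drop w k bound v lv = ≤-trans (occ-≤-cnt w v)
  (s≤s (+-mono-≤ (bound (v ∷ʳ false) (trans (length-∷ʳ v false) (cong suc lv))) (bound (v ∷ʳ true) (trans (length-∷ʳ v true) (cong suc lv)))))

-- P₀ is the text before the block, X the text up to the end of the block, and w the part
-- common to all rotations that make up the block.
module Block (n m D g L : ℕ) ⦃ _ : NonZero n ⦄ (n≡3+m : n ≡ 3 + m) (w P₀ X : Str)
  (C : Complete (suc m) P₀) (U : Unique n w) (lenw : length w ≤ L)
  (big : (length X + 3) * (length X + 3) ≤ 2 ^ g) where

  -- A stage of the encoding: `x` is read and `z` comes next. The first half transfers completeness
  -- from `P₀` to `x`, the second bounds all counts in `x` by those in `X`.
  Fits : Str → Str → Set
  Fits x z = (∃[ y ] x ≡ P₀ ++ y) × (∃[ r ] X ≡ x ++ z ++ r)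

  fits-++ : ∀ x y z → Fits x (y ++ z) → Fits (x ++ y) z
  fits-++ x y z ((y₀ , refl) , (r , eq)) = (y₀ ++ y , ++-assoc P₀ y₀ y) ,
    (r , trans eq (trans (cong (x ++_) (++-assoc y z r)) (sym (++-assoc x y (z ++ r)))))

  fits-take : ∀ x y z → Fits x (y ++ z) → Fits x y
  fits-take x y z (p , (r , eq)) = p , (z ++ r , trans eq (cong (x ++_) (++-assoc y z r)))

  fits-length : ∀ {x z} → Fits x z → length x ≤ length X
  fits-length {x} {z} (_ , (r , eq)) = subst (length x ≤_) (sym (trans (cong length eq) (length-++ x))) (m≤m+n _ _)

  fits-occ : ∀ {x z} v → Fits x z → occ v x ≤ occ v X
  fits-occ {x} v (_ , (r , eq)) = subst (λ y → occ v x ≤ occ v y) (sym eq) (occ-++ˡ-≤ v x _)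

  crude : ∀ x z b → Fits x z → let p = encodeBit x b ; T = occ (suf x m) x + 2 in 1 ≤ proj₁ p × proj₂ p ≤ T * T
  crude x z b ((y , refl) , _) = Crude.crude-bit m (P₀ ++ y) (Complete-++ (suc m) P₀ y C) b

  junk-bit : ∀ x z b → Fits x z → Cost (2 ^ g) 1 (encodeBit x b)
  junk-bit x z b f = cost-one (2 ^ g) (encodeBit x b) (proj₁ (crude x z b f))
    (≤-trans (proj₂ (crude x z b f)) (≤-trans (*-mono-≤ T≤ T≤) big))
    where
    T≤ : occ (suf x m) x + 2 ≤ length X + 3
    T≤ = ≤-trans (+-monoˡ-≤ 2 (≤-trans (occ-≤-length (suf x m) x) (s≤s (fits-length {x} {z} f)))) (≤-reflexive (sym (+-suc _ 2)))

  junk-seq : ∀ z x → Fits x z → Cost (2 ^ (g * length z)) 1 (encodeSeq x z)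
  junk-seq [] x f = *-monoˡ-≤ 1 (m^n>0 2 (g * 0))
  junk-seq (b ∷ z) x f = subst (λ α → Cost α 1 (encodeSeq x (b ∷ z)))
    (trans (sym (^-distribˡ-+-* 2 g _)) (cong (2 ^_) (sym (*-suc g (length z)))))
    (cost-⊗ {2 ^ g} {1} {2 ^ (g * length z)} {1} (encodeBit x b) (encodeSeq (x ∷ʳ b) z)
      (junk-bit x (b ∷ z) b f) (junk-seq z (x ∷ʳ b) (fits-++ x (b ∷ []) z f)))

  Segment : Str → Set
  Segment σ = ∃[ a ] ∃[ c ] σ ≡ a ++ w ++ c × length a ≤ n × length c ≤ n

  -- The bits of `a`, of `c` and the first `H` bits of `w` have no full window inside `w` before
  -- them and pay the trivial price `g` each. The others are padded to exactly `L` factors A/B,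
  -- which `B ≤ A` permits, so that the exponents agree across rotations.
  segment-seq : ∀ H (e : Str → ℕ) A B (Q : Str → Str → Set) → B ≤ A →
    (∀ y d z → Q y (d ∷ z) → Q (y ∷ʳ d) z) →
    (∀ y z b r → drop H z ≡ b ∷ r → Fits y z → Q y z → Cost (2 ^ e z * A) B (encodeBit (y ++ take H z) b)) →
    ∀ σ x → Segment σ → Fits x σ → (∀ a → Q (x ++ a) w) →
    Cost (2 ^ (g * (n + H + n) + ∑ e (suffixes w)) * A ^ L) (B ^ L) (encodeSeq x σ)
  segment-seq H e A B Q B≤A step bit σ x (a , c , refl , la , lc) f q = final
    where
    E = ∑ e (suffixes w)
    t = take H w
    ℓ = length (drop H w)
    f₁ : Fits (x ++ a) (w ++ c)
    f₁ = fits-++ x a (w ++ c) f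
    f₂ : Fits (x ++ a) w
    f₂ = fits-take (x ++ a) w c f₁
    f₃ : Fits (x ++ a) t
    f₃ = fits-take (x ++ a) t (drop H w) (subst (Fits (x ++ a)) (sym (take++drop≡id H w)) f₂)
    f₄ : Fits ((x ++ a) ++ w) c
    f₄ = fits-++ (x ++ a) w c f₁
    Q′ = λ y z → Fits y z × Q y z
    core : Cost (2 ^ E * A ^ ℓ) (B ^ ℓ) (encodeSeq ((x ++ a) ++ t) (drop H w))
    core = window-seq H e A B Q′ (λ { y d z (f , q) → fits-++ y (d ∷ []) z f , step y d z q })
             (λ { y z b r eq (f , q) → bit y z b r eq f q }) w (x ++ a) (f₂ , q a)
    whole : Cost (2 ^ (g * length t) * (2 ^ E * A ^ ℓ)) (1 * B ^ ℓ) (encodeSeq (x ++ a) w)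
    whole = subst (λ z → Cost (2 ^ (g * length t) * (2 ^ E * A ^ ℓ)) (1 * B ^ ℓ) (encodeSeq (x ++ a) z)) (take++drop≡id H w)
              (cost-++ {2 ^ (g * length t)} {1} {2 ^ E * A ^ ℓ} {B ^ ℓ} (x ++ a) t (drop H w) (junk-seq t (x ++ a) f₃) core)
    α₁ = (2 ^ (g * length t) * (2 ^ E * A ^ ℓ)) * 2 ^ (g * length c)
    α₂ = 2 ^ (g * length a) * α₁
    all : Cost α₂ (1 * ((1 * B ^ ℓ) * 1)) (encodeSeq x (a ++ w ++ c))
    all = cost-++ {2 ^ (g * length a)} {1} {α₁} {(1 * B ^ ℓ) * 1} x a (w ++ c) (junk-seq a x (fits-take x a (w ++ c) f))
            (cost-++ {2 ^ (g * length t) * (2 ^ E * A ^ ℓ)} {1 * B ^ ℓ} {2 ^ (g * length c)} {1} (x ++ a) w c whole (junk-seq c ((x ++ a) ++ w) f₄))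
    ℓ≤L : ℓ ≤ L
    ℓ≤L = ≤-trans (≤-reflexive (length-drop H w)) (≤-trans (m∸n≤m (length w) H) lenw)
    pad^ : ∀ b → b ^ ℓ * b ^ (L ∸ ℓ) ≡ b ^ L
    pad^ b = trans (sym (^-distribˡ-+-* b ℓ (L ∸ ℓ))) (cong (b ^_) (m+[n∸m]≡n ℓ≤L))
    lt≤H : length t ≤ H
    lt≤H = ≤-trans (≤-reflexive (length-take H w)) (m⊓n≤m H _)
    padded : Cost (α₂ * A ^ (L ∸ ℓ)) (B ^ L) (encodeSeq x (a ++ w ++ c))
    padded = subst (λ β → Cost (α₂ * A ^ (L ∸ ℓ)) β (encodeSeq x (a ++ w ++ c))) (trans (cong (_* B ^ (L ∸ ℓ)) (ones (B ^ ℓ))) (pad^ B))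
      (cost-pad {α₂} {1 * ((1 * B ^ ℓ) * 1)} (A ^ (L ∸ ℓ)) (B ^ (L ∸ ℓ)) (encodeSeq x (a ++ w ++ c)) (^-monoˡ-≤ (L ∸ ℓ) B≤A) all)
      where
      ones : ∀ q → 1 * ((1 * q) * 1) ≡ q
      ones = solve-∀
    α≡ : α₂ * A ^ (L ∸ ℓ) ≡ 2 ^ (g * (length a + length t + length c) + E) * A ^ L
    α≡ = begin
      α₂ * A ^ (L ∸ ℓ)
        ≡⟨ regroup (2 ^ (g * length a)) (2 ^ (g * length t)) (2 ^ E) (A ^ ℓ) (2 ^ (g * length c)) (A ^ (L ∸ ℓ)) ⟩
      (2 ^ (g * length a) * (2 ^ (g * length t) * (2 ^ (g * length c) * 2 ^ E))) * (A ^ ℓ * A ^ (L ∸ ℓ))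
        ≡⟨ cong₂ _*_ pows (pad^ A) ⟩
      2 ^ (g * (length a + length t + length c) + E) * A ^ L ∎
      where
      open ≡-Reasoning
      regroup : ∀ p q r s t u → (p * ((q * (r * s)) * t)) * u ≡ (p * (q * (t * r))) * (s * u)
      regroup = solve-∀
      expo : ∀ g a t c E → g * a + (g * t + (g * c + E)) ≡ g * (a + t + c) + E
      expo = solve-∀
      pows : 2 ^ (g * length a) * (2 ^ (g * length t) * (2 ^ (g * length c) * 2 ^ E)) ≡ 2 ^ (g * (length a + length t + length c) + E)
      pows = begin
        2 ^ (g * length a) * (2 ^ (g * length t) * (2 ^ (g * length c) * 2 ^ E))
          ≡⟨ cong (λ k → 2 ^ (g * length a) * (2 ^ (g * length t) * k)) (^-distribˡ-+-* 2 (g * length c) E) ⟨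
        2 ^ (g * length a) * (2 ^ (g * length t) * 2 ^ (g * length c + E))
          ≡⟨ cong (2 ^ (g * length a) *_) (^-distribˡ-+-* 2 (g * length t) _) ⟨
        2 ^ (g * length a) * 2 ^ (g * length t + (g * length c + E))
          ≡⟨ ^-distribˡ-+-* 2 (g * length a) _ ⟨
        2 ^ (g * length a + (g * length t + (g * length c + E)))
          ≡⟨ cong (2 ^_) (expo g (length a) (length t) (length c) E) ⟩
        2 ^ (g * (length a + length t + length c) + E) ∎
    final : Cost (2 ^ (g * (n + H + n) + E) * A ^ L) (B ^ L) (encodeSeq x (a ++ w ++ c))
    final = cost-mono {α₂ * A ^ (L ∸ ℓ)} {B ^ L} (encodeSeq x (a ++ w ++ c))
      (≤-trans (≤-reflexive α≡) (*-monoˡ-≤ (A ^ L) (^-monoʳ-≤ 2 (+-monoˡ-≤ E (*-monoʳ-≤ g (+-mono-≤ (+-mono-≤ la lt≤H) lc)))))) padded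

  -- The first rotation: T ≤ n 2^⌊T/n⌋ replaces the concavity of the logarithm.

  e₀ : Str → ℕ
  e₀ = after m (λ u b → 2 * ((occ (u ++ []) X + 2) / n))

  E₀ : ℕ
  E₀ = ∑ e₀ (suffixes w)

  first-segment : ∀ σ x → Segment σ → Fits x σ →
    Cost (2 ^ (g * (n + m + n) + E₀) * (n * n) ^ L) (1 ^ L) (encodeSeq x σ)
  first-segment σ x s f = segment-seq m e₀ (n * n) 1 (λ _ _ → ⊤) (*-mono-≤ (>-nonZero⁻¹ n) (>-nonZero⁻¹ n)) (λ _ _ _ _ → tt) bit σ x s f (λ _ → tt)
    where
    bit : ∀ y z b r → drop m z ≡ b ∷ r → Fits y z → ⊤ → Cost (2 ^ e₀ z * (n * n)) 1 (encodeBit (y ++ take m z) b)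
    bit y z b r eq f _ rewrite after-drop m (λ u b → 2 * ((occ (u ++ []) X + 2) / n)) z eq | ++-identityʳ (take m z) =
      cost-one (2 ^ (2 * (T / n)) * (n * n)) (encodeBit x₁ b) (proj₁ cr) (≤-trans (proj₂ cr)
        (≤-trans (*-mono-≤ T′≤ T′≤) (≤-reflexive (trans (square n (2 ^ (T / n)))
          (cong (_* (n * n)) (trans (sym (^-distribˡ-+-* 2 (T / n) (T / n))) (cong (λ k → 2 ^ (T / n + k)) (sym (+-identityʳ (T / n))))))))))
      where
      u = take m z
      x₁ = y ++ u
      T = occ u X + 2
      fx : Fits x₁ (b ∷ r)
      fx = fits-++ y u (b ∷ r) (subst (Fits y) (trans (sym (take++drop≡id m z)) (cong (u ++_) eq)) f)
      cr = crude x₁ (b ∷ r) b fx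
      suf≡ : suf x₁ m ≡ u
      suf≡ = subst (λ k → suf x₁ k ≡ u) (length-take-exact m z eq) (suf-++ y u)
      T′≤ : occ (suf x₁ m) x₁ + 2 ≤ n * 2 ^ (T / n)
      T′≤ = ≤-trans (+-monoˡ-≤ 2 (≤-trans (≤-reflexive (cong (λ v → occ v x₁) suf≡)) (fits-occ {x₁} {b ∷ r} u fx))) (≤-*-2^-quotient T n)
      square : ∀ n p → (n * p) * (n * p) ≡ (p * p) * (n * n)
      square = solve-∀

  -- Each bit taken off the length turns a bound M into 2M + 1: 1, 3, 7, 15.
  occ≤15 : ∀ v → length v ≡ m → occ v w ≤ 15
  occ≤15 = Unique-drop w m (Unique-drop w (1 + m) (Unique-drop w (2 + m) (subst (λ k → Unique k w) n≡3+m U)))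

  E₀-≤ : n * E₀ ≤ 30 * suc (length X) + 4 * suc (length w)
  E₀-≤ = begin
    n * E₀                                                   ≡⟨ ∑-*ˡ n e₀ (suffixes w) ⟨
    ∑ (λ z → n * e₀ z) (suffixes w)                          ≤⟨ ∑-mono (suffixes w) pointwise ⟩
    ∑ (λ z → 2 * occAfter z + 4) (suffixes w)                ≡⟨ ∑-+ (λ z → 2 * occAfter z) (λ _ → 4) (suffixes w) ⟩
    ∑ (λ z → 2 * occAfter z) (suffixes w) + ∑ (λ _ → 4) (suffixes w)
      ≤⟨ +-mono-≤ (≤-reflexive (∑-*ˡ 2 occAfter (suffixes w))) (∑-≤-length (λ _ → 4) 4 (suffixes w) (λ _ → ≤-refl)) ⟩
    2 * ∑ occAfter (suffixes w) + 4 * length (suffixes w)    ≡⟨ cong₂ (λ p q → 2 * p + 4 * q) (occ-sum w X) (length-suffixes w) ⟩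
    2 * ∑ (hits w) (suffixes X) + 4 * suc (length w)
      ≤⟨ +-monoˡ-≤ _ (*-monoʳ-≤ 2 (∑-≤-length (hits w) 15 (suffixes X) (hits-≤ w 15 occ≤15))) ⟩
    2 * (15 * length (suffixes X)) + 4 * suc (length w)      ≡⟨ cong (_+ 4 * suc (length w)) (sym (*-assoc 2 15 (length (suffixes X)))) ⟩
    30 * length (suffixes X) + 4 * suc (length w)            ≡⟨ cong (λ k → 30 * k + 4 * suc (length w)) (length-suffixes X) ⟩
    30 * suc (length X) + 4 * suc (length w) ∎
    where
    open ≤-Reasoning
    -- The empty continuation makes hits plain occurrences; it is the origin of the `++ []` in `e₀`.
    open Hits m m ≤-refl (λ _ → [])
    occAfter : Str → ℕ
    occAfter = after m (λ u b → occ (u ++ []) X)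
    pointwise : ∀ z → n * e₀ z ≤ 2 * occAfter z + 4
    pointwise z with drop m z
    ... | [] = ≤-trans (≤-reflexive (*-zeroʳ n)) z≤n
    ... | b ∷ r = begin
      n * (2 * (T / n))   ≡⟨ swap n (T / n) ⟩
      2 * (T / n * n)     ≤⟨ *-monoʳ-≤ 2 (m/n*n≤m T n) ⟩
      2 * T               ≡⟨ *-distribˡ-+ 2 (occ (take m z ++ []) X) 2 ⟩
      2 * occ (take m z ++ []) X + 4 ∎
      where
      T = occ (take m z ++ []) X + 2
      swap : ∀ n q → n * (2 * q) ≡ 2 * (q * n)
      swap = solve-∀

  wrong : Str → ℕ
  wrong = after (n + D) (λ u b → occ (u ∷ʳ not b) X)

  W : ℕ
  W = ∑ wrong (suffixes w)

  W-≤ : suc D * W ≤ length X + suc D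
  W-≤ = Wrong.wrong-sum n D w U X

  -- Credits `j` earlier copies of `w` through their factors, a form that persists when bits move
  -- from `z` to `y`. Factors are nonempty because new copies are added by `occ-superadditive`.
  Seen : ℕ → Str → Str → Set
  Seen j y z = ∀ v → 1 ≤ length v → 1 ≤ occ v z → j ≤ occ v y

  -- If the wrong continuation occurs o > 0 times in `X`, the bit is charged g·o instead of g, so
  -- that the charges add up to `g * W`. If o = 0, it does not occur in the text read so far either,
  -- and the window is a deterministic context with count at least `j`.
  later-segment : ∀ j σ x → 1 ≤ j → Segment σ → Fits x σ → Seen j x w →
    Cost (2 ^ (g * (n + (n + D) + n) + g * W) * suc j ^ L) (j ^ L) (encodeSeq x σ)
  later-segment j σ x 1≤j s f seen = subst (λ E → Cost (2 ^ (g * (n + (n + D) + n) + E) * suc j ^ L) (j ^ L) (encodeSeq x σ))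
      (∑-*ˡ g wrong (suffixes w))
      (segment-seq (n + D) (λ z → g * wrong z) (suc j) j (Seen j) (n≤1+n j) step bit σ x s f
        (λ a v 1≤ le → ≤-trans (seen v 1≤ le) (occ-++ˡ-≤ v x a)))
    where
    H = n + D
    step : ∀ y d z → Seen j y (d ∷ z) → Seen j (y ∷ʳ d) z
    step y d z q v 1≤ le = ≤-trans (q v 1≤ (≤-trans le (occ-tail-≤ v d z))) (occ-++ˡ-≤ v y (d ∷ []))
    bit : ∀ y z b r → drop H z ≡ b ∷ r → Fits y z → Seen j y z → Cost (2 ^ (g * wrong z) * suc j) j (encodeBit (y ++ take H z) b)
    bit y z b r eq f q rewrite after-drop H (λ u b → occ (u ∷ʳ not b) X) z eq = go (occ (u ∷ʳ not b) X) refl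
      where
      u = take H z
      x₁ = y ++ u
      z≡ : z ≡ u ++ b ∷ r
      z≡ = trans (sym (take++drop≡id H z)) (cong (u ++_) eq)
      fx : Fits x₁ (b ∷ r)
      fx = fits-++ y u (b ∷ r) (subst (Fits y) z≡ f)
      seen-ub : j ≤ cnt x₁ u b
      seen-ub = ≤-trans (q (u ∷ʳ b) (subst (1 ≤_) (sym (length-∷ʳ u b)) (s≤s z≤n))
        (subst (λ k → 1 ≤ occ (u ∷ʳ b) k) (sym (trans z≡ (sym (++-assoc u (b ∷ []) r)))) (occ-prefix (u ∷ʳ b) r)))
        (occ-++ˡ-≤ (u ∷ʳ b) y u)
      go : ∀ o → occ (u ∷ʳ not b) X ≡ o → Cost (2 ^ (g * o) * suc j) j (encodeBit x₁ b)
      go zero o≡ = subst (λ α → Cost α j (encodeBit x₁ b)) (sym (trans (cong (λ k → 2 ^ k * suc j) (*-zeroʳ g)) (*-identityˡ (suc j))))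
        (deterministic-bit y u b j 1≤j seen-ub (n≤0⇒n≡0 (≤-trans (fits-occ {x₁} {b ∷ r} (u ∷ʳ not b) fx) (≤-reflexive o≡))))
      go (suc o) _ = cost-mono {2 ^ g * suc j} {j} (encodeBit x₁ b)
        (*-monoˡ-≤ (suc j) (^-monoʳ-≤ 2 (m≤m*n g (suc o))))
        (subst (λ β → Cost (2 ^ g * suc j) β (encodeBit x₁ b)) (*-identityˡ j)
          (cost-pad {2 ^ g} {1} (suc j) j (encodeBit x₁ b) (n≤1+n j) (junk-bit x₁ (b ∷ r) b fx)))

  seen-suc : ∀ j x σ → Segment σ → Seen j x w → Seen (suc j) (x ++ σ) w
  seen-suc j x σ (a , c , refl , _) q (d ∷ v) 1≤ le = ≤-trans
    (≤-trans (≤-reflexive (+-comm 1 j)) (+-mono-≤ (q (d ∷ v) 1≤ le)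
      (≤-trans le (≤-trans (occ-++ˡ-≤ (d ∷ v) w c) (occ-++ʳ-≤ (d ∷ v) a (w ++ c))))))
    (occ-superadditive d v x σ)

  F₀ F : ℕ
  F₀ = g * (n + m + n) + E₀
  F = g * (n + (n + D) + n) + g * W

  -- Telescoping: `suc j ^ L` is the numerator of the present rotation and the denominator of the
  -- remaining ones, and `cost-cancel` removes it.
  later-segments : ∀ σs j x → 1 ≤ j → All Segment σs → Fits x (concat σs) → Seen j x w →
    Cost (2 ^ (F * length σs) * (j + length σs) ^ L) (j ^ L) (encodeSeq x (concat σs))
  later-segments [] j x 1≤j _ f _ = ≤-reflexive (begin
    1 * j ^ L                       ≡⟨ *-comm 1 (j ^ L) ⟩
    j ^ L * 1                       ≡⟨ cong (λ k → k ^ L * 1) (+-identityʳ j) ⟨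
    (j + 0) ^ L * 1                 ≡⟨ cong (_* 1) (*-identityˡ ((j + 0) ^ L)) ⟨
    (1 * (j + 0) ^ L) * 1           ≡⟨ cong (λ k → (2 ^ k * (j + 0) ^ L) * 1) (*-zeroʳ F) ⟨
    (2 ^ (F * 0) * (j + 0) ^ L) * 1 ∎)
    where open ≡-Reasoning
  later-segments (σ ∷ σs) j x 1≤j (s ∷ ss) f seen =
    cost-cancel {2 ^ (F * suc k) * (j + suc k) ^ L} {j ^ L} (suc j ^ L) (encodeSeq x (σ ++ concat σs)) (m^n>0 (suc j) L)
      (subst (λ α → Cost α (j ^ L * suc j ^ L) (encodeSeq x (σ ++ concat σs))) arith
        (cost-++ {2 ^ F * suc j ^ L} {j ^ L} {2 ^ (F * k) * (suc j + k) ^ L} {suc j ^ L} x σ (concat σs)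
          (later-segment j σ x 1≤j s (fits-take x σ (concat σs) f) seen)
          (later-segments σs (suc j) (x ++ σ) (s≤s z≤n) ss (fits-++ x σ (concat σs) f) (seen-suc j x σ s seen))))
    where
    k = length σs
    regroup : ∀ p q r s → (p * q) * (r * s) ≡ ((p * r) * s) * q
    regroup = solve-∀
    arith : (2 ^ F * suc j ^ L) * (2 ^ (F * k) * (suc j + k) ^ L) ≡ (2 ^ (F * suc k) * (j + suc k) ^ L) * suc j ^ L
    arith = trans (regroup (2 ^ F) (suc j ^ L) (2 ^ (F * k)) ((suc j + k) ^ L))
      (cong₂ (λ p q → (p * q ^ L) * suc j ^ L)
        (trans (sym (^-distribˡ-+-* 2 F (F * k))) (cong (2 ^_) (sym (*-suc F k))))
        (sym (+-suc j k)))

  block-cost : ∀ σ σs → Segment σ → All Segment σs → X ≡ P₀ ++ concat (σ ∷ σs) → suc (length σs) ≤ n →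
    Cost (2 ^ (F₀ + F * n) * (n * n * n) ^ L) 1 (encodeSeq P₀ (concat (σ ∷ σs)))
  block-cost σ σs s ss X≡ len = cost-mono {α} {1} p bound
      (subst (λ β → Cost α β p) (cong₂ _*_ (^-zeroˡ L) (^-zeroˡ L))
        (cost-++ {2 ^ F₀ * (n * n) ^ L} {1 ^ L} {2 ^ (F * k) * suc k ^ L} {1 ^ L} P₀ σ (concat σs)
          (first-segment σ P₀ s (fits-take P₀ σ (concat σs) f))
          -- No copy of `w` is credited before the block; the first rotation supplies one, so the
          -- later ones start from count 1.
          (later-segments σs 1 (P₀ ++ σ) ≤-refl ss (fits-++ P₀ σ (concat σs) f) (seen-suc 0 P₀ σ s (λ _ _ _ → z≤n)))))
    where
    p = encodeSeq P₀ (concat (σ ∷ σs))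
    k = length σs
    f : Fits P₀ (σ ++ concat σs)
    f = ([] , sym (++-identityʳ P₀)) , ([] , trans X≡ (cong (P₀ ++_) (sym (++-identityʳ (σ ++ concat σs)))))
    α = (2 ^ F₀ * (n * n) ^ L) * (2 ^ (F * k) * suc k ^ L)
    bound : α ≤ 2 ^ (F₀ + F * n) * (n * n * n) ^ L
    bound = begin
      α                                                        ≡⟨ *-interchange (2 ^ F₀) ((n * n) ^ L) (2 ^ (F * k)) (suc k ^ L) ⟩
      (2 ^ F₀ * 2 ^ (F * k)) * ((n * n) ^ L * suc k ^ L)       ≤⟨ *-mono-≤ (*-monoʳ-≤ (2 ^ F₀) (^-monoʳ-≤ 2 (*-monoʳ-≤ F (<⇒≤ len)))) (*-monoʳ-≤ ((n * n) ^ L) (^-monoˡ-≤ L len)) ⟩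
      (2 ^ F₀ * 2 ^ (F * n)) * ((n * n) ^ L * n ^ L)           ≡⟨ cong₂ _*_ (sym (^-distribˡ-+-* 2 F₀ (F * n))) (sym (*-^ L (n * n) n)) ⟩
      2 ^ (F₀ + F * n) * (n * n * n) ^ L ∎
      where open ≤-Reasoning

-- The blocks of S

-- A record type, so that unification can read off the pair `q`, which `local-splits` cannot name.
record Splits (q : ℕ × ℕ) (k : ℕ) : Set where
  constructor splits
  field product : 2 ^ proj₁ q * proj₂ q ≡ k

splits-double : ∀ {q h k} → h * 2 ≡ k → Splits q h → Splits (suc (proj₁ q) , proj₂ q) k
splits-double {q} {h} eq (splits p) =
  splits (trans (*-assoc 2 (2 ^ proj₁ q) _) (trans (cong (2 *_) p) (trans (*-comm 2 h) eq)))

even-half : ∀ k → (k % 2 ≡ᵇ 0) ≡ true → k / 2 * 2 ≡ k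
even-half k even = sym (trans (m≡m%n+[m/n]*n k 2)
  (cong (_+ k / 2 * 2) (≡ᵇ⇒≡ (k % 2) 0 (subst Data.Bool.T (sym even) _))))

go-splits : (go : ℕ → ℕ → ℕ → ℕ × ℕ) →
  (∀ m k → go m 0 k ≡ (0 , k)) →
  (∀ m f k → go m (suc f) k ≡
    (if (k % 2 ≡ᵇ 0) ∧ not (k ≡ᵇ 0) then (suc (proj₁ (go m f (k / 2))) , proj₂ (go m f (k / 2))) else (0 , k))) →
  ∀ m f k → Splits (go m f k) k
go-splits go z s m zero k rewrite z m k = splits (*-identityˡ k)
go-splits go z s m (suc f) k rewrite s m f k with k % 2 ≡ᵇ 0 in even | k ≡ᵇ 0
... | false | _ = splits (*-identityˡ k)
... | true | true = splits (*-identityˡ k)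
... | true | false = splits-double (even-half k even) (go-splits go z s m f (k / 2))

-- The local function of twoAdic cannot be named: the underscore in the type of local-splits
-- is solved to it by unification, once the with-abstraction has brought its call into the
-- pattern fragment.
mutual
  twoAdic-splits : ∀ m → Splits (twoAdic m) m
  twoAdic-splits zero = splits refl
  twoAdic-splits (suc f) with (suc f) % 2 ≡ᵇ 0 in even
  ... | false = splits (*-identityˡ (suc f))
  ... | true with (suc f) / 2 | suc f | even-half (suc f) even
  ... | h | p | eq = splits-double eq (local-splits p f h)

  local-splits : ∀ p f h → Splits _ h
  local-splits = go-splits _ (λ _ _ → refl) (λ _ _ _ → refl)

copies : {A : Set} → (ℕ → A) → ℕ → ℕ → List A
copies f p t = concat (map (λ i → replicate t (f i)) (upTo p))

length-concat-uniform : {A : Set} (c : ℕ) (xss : List (List A)) → All (λ xs → length xs ≡ c) xss → length (concat xss) ≡ length xss * c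
length-concat-uniform c [] [] = refl
length-concat-uniform c (xs ∷ xss) (e ∷ es) =
  trans (length-++ xs) (cong₂ _+_ e (length-concat-uniform c xss es))

length-concat-≤ : {A : Set} (c : ℕ) (xss : List (List A)) → All (λ xs → length xs ≤ c) xss → length (concat xss) ≤ length xss * c
length-concat-≤ c [] [] = z≤n
length-concat-≤ c (xs ∷ xss) (e ∷ es) =
  ≤-trans (≤-reflexive (length-++ xs)) (+-mono-≤ e (length-concat-≤ c xss es))

length-copies : {A : Set} (f : ℕ → A) (p t : ℕ) → length (copies f p t) ≡ p * t
length-copies f p t = trans
  (length-concat-uniform t (map (λ i → replicate t (f i)) (upTo p))
    (AllP.map⁺ (All.tabulate λ {i} _ → length-replicate t)))
  (cong (_* t) (trans (length-map _ (upTo p)) (length-upTo p)))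

All-copies : {A : Set} {P : A → Set} (f : ℕ → A) (p t : ℕ) → (∀ i → i < p → P (f i)) → All P (copies f p t)
All-copies f p t h = AllP.concat⁺ (AllP.map⁺ (All.map (λ {i} lt → AllP.replicate⁺ t (h i lt)) (AllP.all-upTo p)))

rotations : ℕ → List Str
rotations n = copies (dbRot n) (2 ^ proj₁ (twoAdic n)) (proj₂ (twoAdic n))

Sblock≡ : ∀ n → Sblock n ≡ concat (rotations n)
Sblock≡ n = trans (cong concat (map-∘ (upTo (2 ^ proj₁ (twoAdic n)))))
  (concat-concat (map (λ i → replicate (proj₂ (twoAdic n)) (dbRot n i)) (upTo (2 ^ proj₁ (twoAdic n)))))

length-rotations : ∀ n → length (rotations n) ≡ n
length-rotations n = trans (length-copies (dbRot n) (2 ^ proj₁ (twoAdic n)) (proj₂ (twoAdic n))) (Splits.product (twoAdic-splits n))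

-- Keeps every rotation offset below n, which makes `drop n (db n)` a common part of all rotations.
2^s≤ : ∀ k → 2 ^ proj₁ (twoAdic (suc k)) ≤ suc k
2^s≤ k with twoAdic (suc k) | Splits.product (twoAdic-splits (suc k))
... | s , suc t | e = subst (2 ^ s ≤_) e (m≤m*n (2 ^ s) (suc t))
... | s , zero | e rewrite *-zeroʳ (2 ^ s) with e
... | ()

All-rotations : ∀ {P : Str → Set} k → (∀ i → i < suc k → P (dbRot (suc k) i)) → All P (rotations (suc k))
All-rotations k h = All-copies (dbRot (suc k)) (2 ^ proj₁ (twoAdic (suc k))) (proj₂ (twoAdic (suc k))) (λ i lt → h i (≤-trans lt (2^s≤ k)))

length-Sblock : ∀ k → length (Sblock (suc k)) ≤ suc k * 2 ^ suc k
length-Sblock k rewrite Sblock≡ (suc k) =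
  ≤-trans (length-concat-≤ (2 ^ suc k) (rotations (suc k)) (All-rotations {λ y → length y ≤ 2 ^ suc k} k (λ i _ → rot i)))
    (≤-reflexive (cong (_* 2 ^ suc k) (length-rotations (suc k))))
  where
  rot : ∀ i → length (dbRot (suc k) i) ≤ 2 ^ suc k
  rot i = ≤-trans (≤-reflexive (trans (length-++-comm (drop i (db (suc k))) _)
    (cong length (take++drop≡id i (db (suc k)))))) (length-db k)

copies-start : ∀ (f : ℕ → Str) p t → ∃[ r ] concat (copies f (suc p) (suc t)) ≡ f 0 ++ r
copies-start f p t = _ , refl

Sblock-starts : ∀ k → ∃[ r ] Sblock (suc k) ≡ db (suc k) ++ r
Sblock-starts k rewrite Sblock≡ (suc k) with 2 ^ proj₁ (twoAdic (suc k)) | proj₂ (twoAdic (suc k)) | Splits.product (twoAdic-splits (suc k))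
... | suc p | suc t | _ with copies-start (dbRot (suc k)) p t
... | r , eq = r , trans eq (cong (λ y → y ++ r) (++-identityʳ (db (suc k))))
Sblock-starts k | suc p | zero | e rewrite *-zeroʳ p with e
... | ()
Sblock-starts k | zero | t | ()

blocks : ℕ → Str
blocks j = concat (map (λ k → Sblock (suc k)) (upTo j))

blocks-suc : ∀ j → blocks (suc j) ≡ blocks j ++ Sblock (suc j)
blocks-suc j = begin
  concat (map S (upTo (suc j)))               ≡⟨ cong (λ l → concat (map S l)) (upTo-∷ʳ j) ⟨
  concat (map S (upTo j ∷ʳ j))                ≡⟨ cong concat (map-++ S (upTo j) (j ∷ [])) ⟩
  concat (map S (upTo j) ++ S j ∷ [])         ≡⟨ concat-++ (map S (upTo j)) (S j ∷ []) ⟨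
  blocks j ++ (S j ++ [])                     ≡⟨ cong (blocks j ++_) (++-identityʳ (S j)) ⟩
  blocks j ++ S j ∎
  where
  open ≡-Reasoning
  S = λ k → Sblock (suc k)

length-blocks : ∀ j → length (blocks j) ≤ j * 2 ^ suc j
length-blocks zero = z≤n
length-blocks (suc j) = begin
  length (blocks (suc j))                           ≡⟨ cong length (blocks-suc j) ⟩
  length (blocks j ++ Sblock (suc j))               ≡⟨ length-++ (blocks j) ⟩
  length (blocks j) + length (Sblock (suc j))       ≤⟨ +-mono-≤ (length-blocks j) (length-Sblock j) ⟩
  j * 2 ^ suc j + suc j * 2 ^ suc j                 ≤⟨ +-monoˡ-≤ _ (*-monoˡ-≤ (2 ^ suc j) (n≤1+n j)) ⟩
  suc j * 2 ^ suc j + suc j * 2 ^ suc j             ≡⟨ double (suc j) (2 ^ suc j) ⟩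
  suc j * 2 ^ suc (suc j) ∎
  where
  open ≤-Reasoning
  double : ∀ a b → a * b + a * b ≡ a * (2 * b)
  double = solve-∀

-- The last block begins with the unrotated db(j+1). The length is `j` and not `suc j` because the
-- de Bruijn word is read linearly here, without its cyclic windows.
blocks-Complete : ∀ j → Complete j (blocks (suc j))
blocks-Complete j v lv with Sblock-starts j
... | r , eq = subst (λ x → 1 ≤ occ v x) (sym (trans (blocks-suc j) (cong (blocks j ++_) eq)))
  (≤-trans (db-Complete j v lv) (≤-trans (occ-++ˡ-≤ v (db (suc j)) r) (occ-++ʳ-≤ v (blocks j) _)))

-- The final estimate

n^8≤ : ∀ n → n ^ 8 ≤ 8 ^ 8 * 2 ^ n
n^8≤ n = begin
  n ^ 8                         ≤⟨ ^-monoˡ-≤ 8 (≤-*-2^-quotient n 8) ⟩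
  (8 * 2 ^ (n / 8)) ^ 8         ≡⟨ *-^ 8 8 (2 ^ (n / 8)) ⟩
  8 ^ 8 * (2 ^ (n / 8)) ^ 8     ≡⟨ cong (8 ^ 8 *_) (^-*-assoc 2 (n / 8) 8) ⟩
  8 ^ 8 * 2 ^ (n / 8 * 8)       ≤⟨ *-monoʳ-≤ (8 ^ 8) (^-monoʳ-≤ 2 (m/n*n≤m n 8)) ⟩
  8 ^ 8 * 2 ^ n ∎
  where open ≤-Reasoning

module Final (n : ℕ) (h : 2 ^ 27 ≤ n) where
  L : ℕ
  L = 2 ^ n

  64≤n : 64 ≤ n
  64≤n = ≤-trans (^-monoʳ-≤ 2 {6} {27} (toWitness {a? = 6 ≤? 27} _)) h

  instance
    n≢0 : NonZero n
    n≢0 = >-nonZero (≤-trans (s≤s z≤n) 64≤n)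

  -- The constant 8^8 = 2^24 lies below the threshold for `n`, so one factor `n` of n^8 absorbs it.
  n^7≤L : n ^ 7 ≤ L
  n^7≤L = *-cancelˡ-≤ n (≤-trans (n^8≤ n) (*-monoˡ-≤ L (≤-trans (^-monoʳ-≤ 2 {24} {27} (toWitness {a? = 24 ≤? 27} _)) h)))

  n^k≤L : ∀ k → k ≤ 7 → n ^ k ≤ L
  n^k≤L k le = ≤-trans (^-monoʳ-≤ n le) n^7≤L

  c*n^k≤L : ∀ c k → c ≤ 64 → suc k ≤ 7 → c * n ^ k ≤ L
  c*n^k≤L c k c≤ k≤ = ≤-trans (*-monoˡ-≤ (n ^ k) (≤-trans c≤ 64≤n)) (n^k≤L (suc k) k≤)

  1≤L : 1 ≤ L
  1≤L = m^n>0 2 n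

  D : ℕ
  D = n * n * n * n

  -- 27 is log₂ of the threshold for n, so 2^(27·4L) ≤ n^(4L).
  exponent-≤ : ∀ m ℓ w E W → m ≤ n → ℓ ≤ n * L + n * L → w ≤ L →
    n * E ≤ 30 * suc ℓ + 4 * suc w → suc D * W ≤ ℓ + suc D →
    (6 * n * (n + m + n) + E) + (6 * n * (n + (n + D) + n) + 6 * n * W) * n ≤ 27 * (4 * L)
  exponent-≤ m ℓ w E W m≤ ℓ≤ w≤ E≤ W≤ = begin
    (6 * n * (n + m + n) + E) + (6 * n * (n + (n + D) + n) + 6 * n * W) * n
      ≤⟨ +-monoˡ-≤ _ (+-monoˡ-≤ E (*-monoʳ-≤ (6 * n) (+-monoˡ-≤ n (+-monoʳ-≤ n m≤)))) ⟩
    (6 * n * (n + n + n) + E) + (6 * n * (n + (n + D) + n) + 6 * n * W) * n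
      ≡⟨ regroup n E W ⟩
    18 * n ^ 2 + E + (18 * n ^ 3 + 6 * n ^ 6 + 6 * (n ^ 2 * W))
      ≤⟨ +-mono-≤ (+-mono-≤ (c*n^k≤L 18 2 (m≤m+n 18 46) (m≤m+n 3 4)) E≤66L)
           (+-mono-≤ (+-mono-≤ (c*n^k≤L 18 3 (m≤m+n 18 46) (m≤m+n 4 3)) (c*n^k≤L 6 6 (m≤m+n 6 58) ≤-refl)) W≤4L) ⟩
    L + 66 * L + (L + L + 4 * L)
      ≡⟨ sum73 L ⟩
    73 * L
      ≤⟨ *-monoˡ-≤ L (m≤m+n 73 35) ⟩
    108 * L
      ≡⟨ *-assoc 27 4 L ⟩
    27 * (4 * L) ∎
    where
    open ≤-Reasoning
    regroup : ∀ n E W → (6 * n * (n + n + n) + E) + (6 * n * (n + (n + n * n * n * n) + n) + 6 * n * W) * n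
      ≡ 18 * (n * (n * 1)) + E + (18 * (n * (n * (n * 1))) + 6 * (n * (n * (n * (n * (n * (n * 1)))))) + 6 * ((n * (n * 1)) * W))
    regroup = solve-∀
    sum73 : ∀ L → L + 66 * L + (L + L + 4 * L) ≡ 73 * L
    sum73 = solve-∀
    1≤nL : 1 ≤ n * L
    1≤nL = ≤-trans 1≤L (m≤n*m L n)
    E≤66L : E ≤ 66 * L
    E≤66L = *-cancelˡ-≤ n (begin
      n * E                                         ≤⟨ E≤ ⟩
      30 * suc ℓ + 4 * suc w                        ≤⟨ +-mono-≤ (*-monoʳ-≤ 30 (s≤s ℓ≤)) (*-monoʳ-≤ 4 (s≤s w≤)) ⟩
      30 * suc (n * L + n * L) + 4 * suc L          ≡⟨ expand (n * L) L ⟩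
      60 * (n * L) + 34 * 1 + 4 * L                 ≤⟨ +-mono-≤ (+-monoʳ-≤ (60 * (n * L)) (*-monoʳ-≤ 34 1≤L)) ≤-refl ⟩
      60 * (n * L) + 34 * L + 4 * L                 ≡⟨ collect (n * L) L ⟩
      60 * (n * L) + 38 * L                         ≤⟨ +-monoʳ-≤ (60 * (n * L)) (*-monoˡ-≤ L (≤-trans (m≤m+n 38 26) 64≤n)) ⟩
      60 * (n * L) + n * L                          ≤⟨ m≤m+n _ (5 * (n * L)) ⟩
      60 * (n * L) + n * L + 5 * (n * L)            ≡⟨ last n L ⟩
      n * (66 * L) ∎)
      where
      expand : ∀ a L → 30 * suc (a + a) + 4 * suc L ≡ 60 * a + 34 * 1 + 4 * L
      expand = solve-∀
      collect : ∀ a L → 60 * a + 34 * L + 4 * L ≡ 60 * a + 38 * L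
      collect = solve-∀
      last : ∀ n L → 60 * (n * L) + n * L + 5 * (n * L) ≡ n * (66 * L)
      last = solve-∀
    n³W≤ : n ^ 3 * W ≤ 4 * L
    n³W≤ = *-cancelˡ-≤ n (begin
      n * (n ^ 3 * W)              ≡⟨ to-D n W ⟩
      D * W                        ≤⟨ m≤n+m (D * W) W ⟩
      suc D * W                    ≤⟨ W≤ ⟩
      ℓ + suc D                    ≤⟨ +-monoˡ-≤ (suc D) ℓ≤ ⟩
      n * L + n * L + suc D        ≤⟨ +-monoʳ-≤ (n * L + n * L) (+-mono-≤ 1≤nL D≤nL) ⟩
      n * L + n * L + (n * L + n * L) ≡⟨ four n L ⟩
      n * (4 * L) ∎)
      where
      to-D : ∀ n W → n * ((n * (n * (n * 1))) * W) ≡ n * n * n * n * W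
      to-D = solve-∀
      four : ∀ n L → n * L + n * L + (n * L + n * L) ≡ n * (4 * L)
      four = solve-∀
      D≡ : ∀ n → n * n * n * n ≡ n * (n * (n * (n * 1)))
      D≡ = solve-∀
      D≤nL : D ≤ n * L
      D≤nL = ≤-trans (≤-reflexive (D≡ n)) (*-monoʳ-≤ n (n^k≤L 3 (m≤m+n 3 4)))
    W≤4L : 6 * (n ^ 2 * W) ≤ 4 * L
    W≤4L = ≤-trans (*-monoˡ-≤ (n ^ 2 * W) (≤-trans (m≤m+n 6 58) 64≤n)) (≤-trans (≤-reflexive (sym (*-assoc n (n ^ 2) W))) n³W≤)

  -- Origin of `g` = 6n: ℓ + 3 is at most L^3, and an escape followed by an emission squares this.
  junk-≤ : ∀ ℓ → ℓ ≤ n * L + n * L → (ℓ + 3) * (ℓ + 3) ≤ 2 ^ (6 * n)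
  junk-≤ ℓ ℓ≤ = begin
    (ℓ + 3) * (ℓ + 3)               ≤⟨ *-mono-≤ step step ⟩
    (L * (L * L)) * (L * (L * L))   ≡⟨ cong₂ _*_ cube cube ⟩
    2 ^ (n + (n + n)) * 2 ^ (n + (n + n)) ≡⟨ ^-distribˡ-+-* 2 (n + (n + n)) (n + (n + n)) ⟨
    2 ^ (n + (n + n) + (n + (n + n))) ≡⟨ cong (2 ^_) (six n) ⟩
    2 ^ (6 * n) ∎
    where
    open ≤-Reasoning
    six : ∀ n → n + (n + n) + (n + (n + n)) ≡ 6 * n
    six = solve-∀
    cube : L * (L * L) ≡ 2 ^ (n + (n + n))
    cube = trans (cong (L *_) (sym (^-distribˡ-+-* 2 n n))) (sym (^-distribˡ-+-* 2 n (n + n)))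
    n≤L : n ≤ L
    n≤L = ≤-trans (n≤1+n n) (suc≤2^ n)
    1≤LL : 1 ≤ L * L
    1≤LL = *-mono-≤ 1≤L 1≤L
    step : ℓ + 3 ≤ L * (L * L)
    step = begin
      ℓ + 3                             ≤⟨ +-monoˡ-≤ 3 ℓ≤ ⟩
      n * L + n * L + 3                 ≤⟨ +-mono-≤ (+-mono-≤ (*-monoˡ-≤ L n≤L) (*-monoˡ-≤ L n≤L)) (*-monoʳ-≤ 3 1≤LL) ⟩
      L * L + L * L + 3 * (L * L)       ≡⟨ five (L * L) ⟩
      5 * (L * L)                       ≤⟨ *-monoˡ-≤ (L * L) (≤-trans (m≤m+n 5 59) (≤-trans 64≤n n≤L)) ⟩
      L * (L * L) ∎
      where
      five : ∀ a → a + a + 3 * a ≡ 5 * a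
      five = solve-∀

  bound-≤ : ∀ E → E ≤ 27 * (4 * L) → 2 ^ E * (n * n * n) ^ L ≤ boundPow n
  bound-≤ E E≤ = begin
    2 ^ E * (n * n * n) ^ L           ≤⟨ *-monoˡ-≤ _ (^-monoʳ-≤ 2 E≤) ⟩
    2 ^ (27 * (4 * L)) * (n * n * n) ^ L ≡⟨ cong (_* (n * n * n) ^ L) (^-*-assoc 2 27 (4 * L)) ⟨
    (2 ^ 27) ^ (4 * L) * (n * n * n) ^ L ≤⟨ *-mono-≤ (^-monoˡ-≤ (4 * L) h) (≤-reflexive cubes) ⟩
    n ^ (4 * L) * n ^ (3 * L)         ≡⟨ ^-distribˡ-+-* n (4 * L) (3 * L) ⟨
    -- Of the 7L factors `n`, 4L pay for the power of 2 and 3L for the cube; regrouped, 5L fit into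
    -- the first factor of the bound and 2L = 2^(n+1) into its last.
    n ^ (4 * L + 3 * L)               ≡⟨ cong (n ^_) (seven L) ⟩
    n ^ (5 * L + 2 * L)               ≡⟨ ^-distribˡ-+-* n (5 * L) (2 * L) ⟩
    n ^ (5 * L) * n ^ (2 * L)         ≤⟨ *-mono-≤ (^-monoʳ-≤ n (*-monoʳ-≤ 5 (≤-trans (m≤m+n L (2 * n)) (m≤m+n (L + 2 * n) (n * n)))))
                                           (m≤n*m (n ^ (2 * L)) ((n ∸ 1) ^ n) ⦃ m^n≢0 (n ∸ 1) n ⦃ >-nonZero (∸-monoˡ-≤ {2} 1 (≤-trans (m≤m+n 2 62) 64≤n)) ⦄ ⦄) ⟩
    boundPow n ∎
    where
    open ≤-Reasoning
    seven : ∀ L → 4 * L + 3 * L ≡ 5 * L + 2 * L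
    seven = solve-∀
    cube : ∀ n → n * n * n ≡ n * (n * (n * 1))
    cube = solve-∀
    cubes : (n * n * n) ^ L ≡ n ^ (3 * L)
    cubes = trans (cong (_^ L) (cube n)) (^-*-assoc n 3 L)

-- The prefix `a` consists of the bits of `db n` from position i up to n - 1, and `c` of the first i
-- bits, moved to the end.
rotation-segment : ∀ n i → i ≤ n → ∃[ a ] ∃[ c ] dbRot n i ≡ a ++ drop n (db n) ++ c × length a ≤ n × length c ≤ n
rotation-segment n i i≤n = take (n ∸ i) (drop i (db n)) , take i (db n) , eq ,
  ≤-trans (≤-reflexive (length-take (n ∸ i) _)) (≤-trans (m⊓n≤m (n ∸ i) _) (m∸n≤m n i)) ,
  ≤-trans (≤-reflexive (length-take i (db n))) (≤-trans (m⊓n≤m i _) i≤n)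
  where
  eq : dbRot n i ≡ take (n ∸ i) (drop i (db n)) ++ drop n (db n) ++ take i (db n)
  eq = begin
    drop i (db n) ++ take i (db n)
      ≡⟨ cong (_++ take i (db n)) (take++drop≡id (n ∸ i) (drop i (db n))) ⟨
    (take (n ∸ i) (drop i (db n)) ++ drop (n ∸ i) (drop i (db n))) ++ take i (db n)
      ≡⟨ ++-assoc (take (n ∸ i) (drop i (db n))) _ _ ⟩
    take (n ∸ i) (drop i (db n)) ++ drop (n ∸ i) (drop i (db n)) ++ take i (db n)
      ≡⟨ cong (λ z → take (n ∸ i) (drop i (db n)) ++ z ++ take i (db n))
           (trans (drop-drop i (n ∸ i) (db n)) (cong (λ k → drop k (db n)) (m+[n∸m]≡n i≤n))) ⟩
    take (n ∸ i) (drop i (db n)) ++ drop n (db n) ++ take i (db n) ∎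
    where open ≡-Reasoning

ppmSn-≤ : ∀ n m → n ≡ 3 + m → 2 ^ 27 ≤ n → proj₂ (ppmSn n) ≤ boundPow n * proj₁ (ppmSn n)
ppmSn-≤ n m n≡ h = ≤-trans (≤-reflexive (sym (*-identityʳ (proj₂ (ppmSn n)))))
    (≤-trans cost (*-monoˡ-≤ (proj₁ (ppmSn n)) (bound-≤ (Bl.F₀ + Bl.F * n) exponent)))
  where
  open Final n h
  P₀ = prefixS n
  X = P₀ ++ Sblock n
  w = drop n (db n)
  at : (P : ℕ → Set) → P (3 + m) → P n
  at P = subst P (sym n≡)
  lenP : length P₀ ≤ n * L
  lenP = at (λ k → length (prefixS k) ≤ k * 2 ^ k)
    (≤-trans (length-blocks (2 + m)) (*-monoˡ-≤ (2 ^ (3 + m)) (n≤1+n (2 + m))))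
  ℓ≤ : length X ≤ n * L + n * L
  ℓ≤ = ≤-trans (≤-reflexive (length-++ P₀)) (+-mono-≤ lenP (at (λ k → length (Sblock k) ≤ k * 2 ^ k) (length-Sblock (2 + m))))
  lenw : length w ≤ L
  lenw = ≤-trans (≤-reflexive (length-drop n (db n))) (≤-trans (m∸n≤m (length (db n)) n) (at (λ k → length (db k) ≤ 2 ^ k) (length-db (2 + m))))
  -- For n = 3 + m, `prefixS n` unfolds to `blocks (2 + m)`, which contains all words of length 1 +
  -- m = n - 2.
  module Bl = Block n m D (6 * n) L n≡ w P₀ X (at (λ k → Complete (suc m) (prefixS k)) (blocks-Complete (suc m)))
    (λ v lv → ≤-trans (occ-drop-≤ v n (db n)) (at (λ k → Unique k (db k)) (db-Unique (2 + m)) v lv)) lenw (junk-≤ (length X) ℓ≤)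
  exponent : Bl.F₀ + Bl.F * n ≤ 27 * (4 * L)
  exponent = exponent-≤ m (length X) (length w) Bl.E₀ Bl.W (≤-trans (m≤n+m m 3) (≤-reflexive (sym n≡))) ℓ≤ lenw Bl.E₀-≤ Bl.W-≤
  segments : All Bl.Segment (rotations n)
  segments = at (λ k → (∀ i → i < k → Bl.Segment (dbRot k i)) → All Bl.Segment (rotations k)) (All-rotations (2 + m))
    (λ i lt → rotation-segment n i (<⇒≤ lt))
  assemble : ∀ σs → All Bl.Segment σs → length σs ≡ n → Sblock n ≡ concat σs →
    Cost (2 ^ (Bl.F₀ + Bl.F * n) * (n * n * n) ^ L) 1 (ppmSn n)
  assemble [] _ len _ = contradiction (sym len) (m<n⇒n≢0 (≤-trans (m≤m+n 1 63) 64≤n))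
  assemble (σ ∷ σs) (s ∷ ss) len eq = subst (λ y → Cost (2 ^ (Bl.F₀ + Bl.F * n) * (n * n * n) ^ L) 1 (encodeSeq P₀ y)) (sym eq)
    (Bl.block-cost σ σs s ss (cong (P₀ ++_) eq) (≤-reflexive len))
  cost : Cost (2 ^ (Bl.F₀ + Bl.F * n) * (n * n * n) ^ L) 1 (ppmSn n)
  cost = assemble (rotations n) segments (length-rotations n) (Sblock≡ n)

theorem1 : ∃[ N₀ ] (∀ n → N₀ ≤ n → proj₂ (ppmSn n) ≤ boundPow n * proj₁ (ppmSn n))
theorem1 = 2 ^ 27 , λ n h → ppmSn-≤ n (n ∸ 3) (sym (m+[n∸m]≡n (≤-trans (m≤m+n 3 61) (Final.64≤n n h)))) h
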